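{- For all pairs of twin binary trees $J_0$ and $J_1$, the product of $\mathbf{Baxter}$ satisfies $$\mathbf{P}_{J_0} \cdot \mathbf{P}_{J_1} = \sum_{J_0 / J_1 \,\leq_{\mathrm{B}}\, J \,\leq_{\mathrm{B}}\, J_0 \backslash J_1} \mathbf{P}_J .$$
   Context: $\mathbb{K}$ is a field of characteristic zero. $\mathfrak{S}$ is the set of all permutations (of all sizes $n\ge0$), seen as words; $\mathrm{std}(u)$ is the unique permutation of size $|u|$ with the same inversions as $u$. $\mathbf{FQSym}$ is the Hopf algebra over $\mathbb{K}$ with basis $\{\mathbf{F}_\sigma\}_{\sigma\in\mathfrak{S}}$, product $\mathbf{F}_\sigma\cdot\mathbf{F}_\nu = \sum_{\pi} \mathbf{F}_\pi$, where $\pi$ runs over all shuffles of $\sigma$ with the word obtained by adding $|\sigma|$ to every letter of $\nu$, and coproduct $\Delta(\mathbf{F}_\sigma) = \sum_{\sigma = uv} \mathbf{F}_{\mathrm{std}(u)} \otimes \mathbf{F}_{\mathrm{std}(v)}$. A binary tree is either a leaf (empty tree) or a node with a left and a right binary subtree. The canopy of a binary tree with $n$ nodes is the word of length $n-1$ obtained by reading its leaves from left to right except the first and the last, writing $0$ if the leaf is a right child and $1$ if it is a left child. A pair of twin binary trees is a pair of binary trees with the same number $n$ of nodes whose canopies differ at every position $1\le i\le n-1$. For a permutation $\sigma$, $\mathsf{P}(\sigma) = (T_L,T_R)$ where $T_L$ (resp. $T_R$) is the shape of the binary search tree obtained by inserting the letters of $\sigma$ from left to right (resp. right to left) with the standard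 binary search tree leaf insertion. $\mathbf{Baxter}$ is the Hopf subalgebra of $\mathbf{FQSym}$ with basis $\{\mathbf{P}_J\}$ indexed by pairs of twin binary trees, where $\mathbf{P}_J = \sum_{\sigma\in\mathfrak{S},\ \mathsf{P}(\sigma) = J} \mathbf{F}_\sigma$. The permutohedron order $\leq_{\mathrm{P}}$ on permutations of size $n$ is the partial order in which $\sigma$ is covered by $\nu$ iff $\sigma = u\,ab\,v$ and $\nu = u\,ba\,v$ for some words $u,v$ and letters $a<b$. The Baxter order on pairs of twin binary trees with $n$ nodes is defined by $J_0 \leq_{\mathrm{B}} J_1$ iff there are permutations $\sigma \leq_{\mathrm{P}} \nu$ of size $n$ with $\mathsf{P}(\sigma) = J_0$ and $\mathsf{P}(\nu) = J_1$. For binary trees $T_0,T_1$, $T_0 / T_1$ is obtained by grafting $T_0$ from its root on the leftmost leaf of $T_1$, and $T_0 \backslash T_1$ by grafting $T_1$ from its root on the rightmost leaf of $T_0$. For pairs of twin binary trees $J_0 = (T^0_L,T^0_R)$ and $J_1 = (T^1_L,T^1_R)$, $J_0 / J_1 := (T^0_L \backslash T^1_L,\ T^0_R / T^1_R)$ and $J_0 \backslash J_1 := (T^0_L / T^1_L,\ T^0_R \backslash T^1_R)$; these are pairs of twin binary trees. -}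

module Defs where

open import Algebra.Apartness.Bundles using (HeytingField; HeytingCommutativeRing)
open import Algebra.Bundles using (CommutativeRing)
import Algebra.Definitions.RawMonoid as RawMonoidDefs
open import Data.Bool.Base using (Bool; true; false; if_then_else_)
import Data.Bool.Properties as Bool
open import Data.Empty using (⊥-elim; ⊥-elim-irr)
open import Data.List.Base
  using (List; []; _∷_; [_]; _++_; length; map; foldl; foldr; take; drop; upTo;
         filter; concatMap; deduplicate; cartesianProductWith)
open import Data.List.Membership.Propositional using (_∈_; lose; find)
open import Data.List.Membership.Propositional.Properties
  using (∈-filter⁺; ∈-filter⁻; ∈-deduplicate⁺; ∈-concatMap⁺; ∈-map⁺; ∈-upTo⁺;
         ∈-cartesianProductWith⁺)
import Data.List.Properties as List
open import Data.List.Relation.Binary.Permutation.Propositional.Properties using (↭-length)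
open import Data.List.Relation.Binary.Pointwise as Pointwise using (Pointwise; []; _∷_)
open import Data.List.Relation.Ternary.Interleaving.Propositional
  using (Interleaving; []; consˡ; consʳ; toPermutation)
open import Data.List.Relation.Unary.All as All using (All; []; _∷_; all?)
open import Data.List.Relation.Unary.Any as Any using (here; any?)
open import Data.List.Relation.Unary.Unique.Propositional using (Unique)
open import Data.List.Relation.Unary.Unique.DecPropositional using (unique?)
open import Data.List.Relation.Unary.Unique.DecPropositional.Properties
  using (deduplicate-!)
open import Data.List.Relation.Unary.Unique.Propositional.Properties using (filter⁺)
open import Data.Nat.Base using (ℕ; zero; suc; _+_; _∸_; _≤_; _<_; s≤s)
open import Data.Nat.ListAction using (sum)
open import Data.Nat.Properties as ℕ using (_<?_; _≤?_)
open import Data.Product.Base using (∃; ∃₂; _×_; _,_; proj₁; proj₂)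
import Data.Product.Properties as Product
open import Data.Sum.Base using (_⊎_; inj₁; inj₂; [_,_]′)
open import Data.Tree.Binary using (Tree; leaf; node; #nodes; mapₙ)
open import Data.Tree.Binary.Properties using (#nodes-mapₙ)
open import Data.Unit.Base using (⊤; tt)
open import Function.Base using (_∘_; flip; const)
open import Level using (Level; _⊔_)
open import Relation.Binary.Construct.Closure.ReflexiveTransitive using (Star; ε; _◅_)
open import Relation.Binary.Definitions using (DecidableEquality)
open import Relation.Binary.PropositionalEquality
  using (_≡_; _≢_; refl; sym; trans; cong; cong₂; subst; subst₂; module ≡-Reasoning)
open import Relation.Nullary.Decidable
  using (Dec; yes; no; does; recompute; map′; ¬?; _×-dec_; _⊎-dec_)
open import Relation.Nullary.Negation using (¬_; contradiction)
open import Relation.Unary using (Decidable)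

private
  variable
    a p : Level
    A : Set a

-- A duplicate-free list of exactly the elements satisfying P; this is the index set of
-- every finite sum below.
record Enumeration {A : Set a} (P : A → Set p) : Set (a ⊔ p) where
  field
    elements : List A
    unique   : Unique elements
    sound    : ∀ {x} → x ∈ elements → P x
    complete : ∀ {x} → P x → x ∈ elements

enumerate : {P : A → Set p} → DecidableEquality A → Decidable P →
            (xs : List A) → (∀ {x} → P x → x ∈ xs) → Enumeration P
enumerate _≟_ P? xs P⊆xs = record
  { elements = filter P? (deduplicate _≟_ xs)
  ; unique   = filter⁺ P? (deduplicate-! _≟_ xs)
  ; sound    = λ x∈ → proj₂ (∈-filter⁻ P? {xs = deduplicate _≟_ xs} x∈)
  ; complete = λ px → ∈-filter⁺ P? (∈-deduplicate⁺ _≟_ (P⊆xs px)) px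
  }

IsPermutation : List ℕ → Set
IsPermutation w = All (λ x → 1 ≤ x × x ≤ length w) w × Unique w

isPermutation? : Decidable IsPermutation
isPermutation? w = all? (λ x → (1 ≤? x) ×-dec (x ≤? length w)) w ×-dec unique? ℕ._≟_ w

-- The proof is irrelevant, so two permutations are equal as soon as their words are.
record 𝔖 : Set where
  constructor perm
  field
    word           : List ℕ
    .isPermutation : IsPermutation word

open 𝔖 public

size : 𝔖 → ℕ
size σ = length (word σ)

infix 4 _≟𝔖_

_≟𝔖_ : DecidableEquality 𝔖
perm u _ ≟𝔖 perm v _ = map′ (λ { refl → refl }) (cong word) (List.≡-dec ℕ._≟_ u v)

words : ℕ → ℕ → List (List ℕ)
words k zero    = [ [] ]
words k (suc m) = cartesianProductWith _∷_ (map suc (upTo k)) (words k m)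

∈-words : ∀ k {w} → All (λ x → 1 ≤ x × x ≤ k) w → w ∈ words k (length w)
∈-words k []                               = here refl
∈-words k (_∷_ {x = suc x} (_ , x<k) rest) =
  ∈-cartesianProductWith⁺ _∷_ (∈-map⁺ suc (∈-upTo⁺ x<k)) (∈-words k rest)

toPermutations : List ℕ → List 𝔖
toPermutations w with isPermutation? w
... | yes w-perm = [ perm w w-perm ]
... | no _       = []

∈-toPermutations : ∀ σ → σ ∈ toPermutations (word σ)
∈-toPermutations (perm w w-perm) with isPermutation? w
... | yes _   = here refl
... | no ¬perm = ⊥-elim-irr (¬perm w-perm)

permutations : ℕ → List 𝔖
permutations n = concatMap toPermutations (words n n)

∈-permutations : ∀ {n} σ → size σ ≡ n → σ ∈ permutations n
∈-permutations σ@(perm w w-perm) refl =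
  ∈-concatMap⁺ toPermutations
    (lose (∈-words (length w) (proj₁ (recompute (isPermutation? w) w-perm)))
          (∈-toPermutations σ))

interleaving? : (u v w : List ℕ) → Dec (Interleaving u v w)
interleaving? []      []      []      = yes []
interleaving? (_ ∷ _) _       []      = no λ ()
interleaving? []      (_ ∷ _) []      = no λ ()
interleaving? u       v       (z ∷ w) =
  map′ [ fromˡ , fromʳ ]′ to (fromˡ? u ⊎-dec fromʳ? v)
  where
  FromL FromR : Set
  FromL = ∃ λ u′ → u ≡ z ∷ u′ × Interleaving u′ v w
  FromR = ∃ λ v′ → v ≡ z ∷ v′ × Interleaving u v′ w

  fromˡ : FromL → Interleaving u v (z ∷ w)
  fromˡ (_ , refl , i) = consˡ i

  fromʳ : FromR → Interleaving u v (z ∷ w)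
  fromʳ (_ , refl , i) = consʳ i

  to : Interleaving u v (z ∷ w) → FromL ⊎ FromR
  to (consˡ i) = inj₁ (_ , refl , i)
  to (consʳ i) = inj₂ (_ , refl , i)

  fromˡ? : ∀ u₀ → Dec (∃ λ u′ → u₀ ≡ z ∷ u′ × Interleaving u′ v w)
  fromˡ? []       = no λ ()
  fromˡ? (x ∷ u′) = map′ (λ { (refl , i) → u′ , refl , i }) (λ { (_ , refl , i) → refl , i })
                         ((x ℕ.≟ z) ×-dec interleaving? u′ v w)

  fromʳ? : ∀ v₀ → Dec (∃ λ v′ → v₀ ≡ z ∷ v′ × Interleaving u v′ w)
  fromʳ? []       = no λ ()
  fromʳ? (y ∷ v′) = map′ (λ { (refl , i) → v′ , refl , i }) (λ { (_ , refl , i) → refl , i })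
                         ((y ℕ.≟ z) ×-dec interleaving? u v′ w)

ShiftedShuffle : 𝔖 → 𝔖 → 𝔖 → Set
ShiftedShuffle σ ν π = Interleaving (word σ) (map (size σ +_) (word ν)) (word π)

shiftedShuffles : ∀ σ ν → Enumeration (ShiftedShuffle σ ν)
shiftedShuffles σ ν =
  enumerate _≟𝔖_ (λ π → interleaving? _ _ (word π)) (permutations (size σ + size ν))
    λ {π} i → ∈-permutations π (size-shuffle {π} i)
  where
  open ≡-Reasoning
  size-shuffle : ∀ {π} → ShiftedShuffle σ ν π → size π ≡ size σ + size ν
  size-shuffle {π} i = begin
    size π                                        ≡⟨ ↭-length (toPermutation i) ⟩
    length (word σ ++ map (size σ +_) (word ν))   ≡⟨ List.length-++ (word σ) ⟩
    size σ + length (map (size σ +_) (word ν))    ≡⟨ cong (size σ +_) (List.length-map _ (word ν)) ⟩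
    size σ + size ν                               ∎

Swap : List ℕ → List ℕ → Set
Swap w w′ = ∃₂ λ u v → ∃₂ λ a b → a < b × w ≡ u ++ a ∷ b ∷ v × w′ ≡ u ++ b ∷ a ∷ v

infix 4 _⋖_ _≤P_ _⋖?_ _≤P?_

_⋖_ : 𝔖 → 𝔖 → Set
σ ⋖ ν = Swap (word σ) (word ν)

_≤P_ : 𝔖 → 𝔖 → Set
_≤P_ = Star _⋖_

swap? : ∀ w w′ → Dec (Swap w w′)
swap? []      _        = no λ { ([] , _ , _ , _ , _ , () , _) ; (_ ∷ _ , _ , _ , _ , _ , () , _) }
swap? (_ ∷ _) []       = no λ { ([] , _ , _ , _ , _ , _ , ()) ; (_ ∷ _ , _ , _ , _ , _ , _ , ()) }
swap? (x ∷ w) (y ∷ w′) = map′ [ head , tail ]′ split (headSwap? w w′ ⊎-dec ((x ℕ.≟ y) ×-dec swap? w w′))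
  where
  HeadSwap : List ℕ → List ℕ → Set
  HeadSwap w w′ = ∃ λ v → x < y × w ≡ y ∷ v × w′ ≡ x ∷ v

  headSwap? : ∀ w w′ → Dec (HeadSwap w w′)
  headSwap? []      _        = no λ ()
  headSwap? (_ ∷ _) []       = no λ ()
  headSwap? (b ∷ v) (a ∷ v′) =
    map′ (λ { (x<y , refl , refl , refl) → v , x<y , refl , refl })
         (λ { (_ , x<y , refl , refl) → x<y , refl , refl , refl })
         ((x <? y) ×-dec (b ℕ.≟ y) ×-dec (a ℕ.≟ x) ×-dec List.≡-dec ℕ._≟_ v v′)

  head : HeadSwap w w′ → Swap (x ∷ w) (y ∷ w′)
  head (v , x<y , refl , refl) = [] , v , x , y , x<y , refl , refl

  tail : x ≡ y × Swap w w′ → Swap (x ∷ w) (y ∷ w′)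
  tail (refl , u , v , a , b , a<b , refl , refl) = x ∷ u , v , a , b , a<b , refl , refl

  split : Swap (x ∷ w) (y ∷ w′) → HeadSwap w w′ ⊎ (x ≡ y × Swap w w′)
  split ([]    , v , a , b , a<b , refl , refl) = inj₁ (v , a<b , refl , refl)
  split (_ ∷ u , v , a , b , a<b , refl , refl) = inj₂ (refl , u , v , a , b , a<b , refl , refl)

_⋖?_ : ∀ σ ν → Dec (σ ⋖ ν)
σ ⋖? ν = swap? (word σ) (word ν)

swap-length : ∀ {w w′} → Swap w w′ → length w ≡ length w′
swap-length (u , v , a , b , _ , refl , refl) =
  trans (List.length-++ u) (sym (List.length-++ u))

≤P-size : ∀ {σ ν} → σ ≤P ν → size σ ≡ size ν
≤P-size ε       = refl
≤P-size (c ◅ s) = trans (swap-length c) (≤P-size s)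

-- Σᵢ (i - 1) wᵢ, which strictly decreases along covers.
weight : List ℕ → ℕ
weight []      = 0
weight (_ ∷ w) = sum w + weight w

swap-sum : ∀ {w w′} → Swap w w′ → sum w ≡ sum w′
swap-sum ([] , v , a , b , _ , refl , refl) =
  trans (sym (ℕ.+-assoc a b (sum v)))
        (trans (cong (_+ sum v) (ℕ.+-comm a b)) (ℕ.+-assoc b a (sum v)))
swap-sum (x ∷ u , v , a , b , a<b , refl , refl) =
  cong (x +_) (swap-sum (u , v , a , b , a<b , refl , refl))

swap-weight : ∀ {w w′} → Swap w w′ → weight w′ < weight w
swap-weight ([] , v , a , b , a<b , refl , refl) = ℕ.+-monoˡ-< _ (ℕ.+-monoˡ-< (sum v) a<b)
swap-weight (x ∷ u , v , a , b , a<b , refl , refl) =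
  subst (λ s → s + weight (u ++ b ∷ a ∷ v) < sum (u ++ a ∷ b ∷ v) + weight (u ++ a ∷ b ∷ v))
        (swap-sum (u , v , a , b , a<b , refl , refl))
        (ℕ.+-monoʳ-< (sum (u ++ a ∷ b ∷ v)) (swap-weight (u , v , a , b , a<b , refl , refl)))

_≤P?_ : ∀ σ ν → Dec (σ ≤P ν)
σ₀ ≤P? ν = search (suc (weight (word σ₀))) σ₀ (ℕ.n<1+n _)
  where
  search : ∀ n σ → weight (word σ) < n → Dec (σ ≤P ν)
  search (suc n) σ (s≤s σ≤n) with σ ≟𝔖 ν
  ... | yes refl = yes ε
  ... | no σ≢ν   = map′ build unbuild (any? step? (permutations (size σ)))
    where
    Step : 𝔖 → Set
    Step τ = σ ⋖ τ × τ ≤P ν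

    step? : Decidable Step
    step? τ with σ ⋖? τ
    ... | no ¬c = no (¬c ∘ proj₁)
    ... | yes c = map′ (c ,_) proj₂ (search n τ (ℕ.<-≤-trans (swap-weight c) σ≤n))

    build : Any.Any Step (permutations (size σ)) → σ ≤P ν
    build steps with _ , _ , c , s ← find steps = c ◅ s

    unbuild : σ ≤P ν → Any.Any Step (permutations (size σ))
    unbuild ε               = contradiction refl σ≢ν
    unbuild (_◅_ {j = τ} c s) = lose (∈-permutations τ (sym (swap-length c))) (c , s)

BinaryTree : Set
BinaryTree = Tree ⊤ ⊤

_≟ᵗ_ : DecidableEquality BinaryTree
leaf _     ≟ᵗ leaf _       = yes refl
leaf _     ≟ᵗ node _ _ _   = no λ ()
node _ _ _ ≟ᵗ leaf _       = no λ ()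
node l _ r ≟ᵗ node l′ _ r′ =
  map′ (λ { (refl , refl) → refl }) (λ { refl → refl , refl }) ((l ≟ᵗ l′) ×-dec (r ≟ᵗ r′))

-- A letter equal to the label of a node goes to its right; this case does not arise for
-- the letters of a permutation.
insert : ℕ → Tree ℕ ⊤ → Tree ℕ ⊤
insert x (leaf _)     = node (leaf tt) x (leaf tt)
insert x (node l y r) = if does (x <? y) then node (insert x l) y r else node l y (insert x r)

shape : Tree ℕ ⊤ → BinaryTree
shape = mapₙ (const tt)

ℙ : 𝔖 → BinaryTree × BinaryTree
ℙ σ = shape (foldl (flip insert) (leaf tt) (word σ)) , shape (foldr insert (leaf tt) (word σ))

#nodes-insert : ∀ x t → #nodes (insert x t) ≡ suc (#nodes t)
#nodes-insert x (leaf _) = refl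
#nodes-insert x (node l y r) with does (x <? y)
... | true  = cong (_+ suc (#nodes r)) (#nodes-insert x l)
... | false = trans (cong (λ n → #nodes l + suc n) (#nodes-insert x r)) (ℕ.+-suc (#nodes l) _)

#nodes-ℙ : ∀ σ → #nodes (proj₁ (ℙ σ)) ≡ size σ
#nodes-ℙ σ = trans (#nodes-mapₙ _ (foldl (flip insert) (leaf tt) (word σ)))
                   (trans (#nodes-foldl (leaf tt) (word σ)) (ℕ.+-identityʳ (size σ)))
  where
  #nodes-foldl : ∀ t w → #nodes (foldl (flip insert) t w) ≡ length w + #nodes t
  #nodes-foldl t []      = refl
  #nodes-foldl t (x ∷ w) =
    trans (#nodes-foldl (insert x t) w)
          (trans (cong (length w +_) (#nodes-insert x t)) (ℕ.+-suc (length w) _))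

-- The leaves from left to right: true (the letter 1) for a left child, false (the letter 0)
-- for a right child. The Boolean argument is the side on which the whole tree hangs.
leafSides : Bool → BinaryTree → List Bool
leafSides side (leaf _)     = [ side ]
leafSides side (node l _ r) = leafSides true l ++ leafSides false r

-- A tree with n nodes has n + 1 leaves, so this drops the first and the last one. The side
-- chosen for the root does not matter: it only shows for the tree reduced to a leaf.
canopy : BinaryTree → List Bool
canopy t = take (#nodes t ∸ 1) (drop 1 (leafSides true t))

infixl 6 _/ᵗ_ _∖ᵗ_

_/ᵗ_ : BinaryTree → BinaryTree → BinaryTree
t₀ /ᵗ leaf _     = t₀
t₀ /ᵗ node l _ r = node (t₀ /ᵗ l) tt r

_∖ᵗ_ : BinaryTree → BinaryTree → BinaryTree
leaf _     ∖ᵗ t₁ = t₁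
node l _ r ∖ᵗ t₁ = node l tt (r ∖ᵗ t₁)

Twin : BinaryTree → BinaryTree → Set
Twin t s = #nodes t ≡ #nodes s × Pointwise _≢_ (canopy t) (canopy s)

twin? : ∀ t s → Dec (Twin t s)
twin? t s = (#nodes t ℕ.≟ #nodes s) ×-dec
            Pointwise.decidable (λ x y → ¬? (x Bool.≟ y)) (canopy t) (canopy s)

record TwinPair : Set where
  constructor twinPair
  field
    treeᴸ treeᴿ : BinaryTree
    .twin       : Twin treeᴸ treeᴿ

open TwinPair public

trees : TwinPair → BinaryTree × BinaryTree
trees J = treeᴸ J , treeᴿ J

infix 4 _≟²_

_≟²_ : DecidableEquality (BinaryTree × BinaryTree)
_≟²_ = Product.≡-dec _≟ᵗ_ _≟ᵗ_

_≟ᴶ_ : DecidableEquality TwinPair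
J₀ ≟ᴶ J₁ = map′ (λ { refl → refl }) (cong trees) (trees J₀ ≟² trees J₁)

module Grafting where
  open ≡-Reasoning

  #nodes-/ : ∀ t₀ t₁ → #nodes (t₀ /ᵗ t₁) ≡ #nodes t₀ + #nodes t₁
  #nodes-/ t₀ (leaf _)     = sym (ℕ.+-identityʳ _)
  #nodes-/ t₀ (node l _ r) =
    trans (cong (_+ suc (#nodes r)) (#nodes-/ t₀ l)) (ℕ.+-assoc (#nodes t₀) (#nodes l) _)

  #nodes-∖ : ∀ t₀ t₁ → #nodes (t₀ ∖ᵗ t₁) ≡ #nodes t₀ + #nodes t₁
  #nodes-∖ (leaf _)     t₁ = refl
  #nodes-∖ (node l _ r) t₁ =
    trans (cong (λ n → #nodes l + suc n) (#nodes-∖ r t₁)) (sym (ℕ.+-assoc (#nodes l) _ _))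

  -- The leaves of a tree hanging on the left (resp. right), without its first (resp. last).
  tailSides initSides : BinaryTree → List Bool
  tailSides (leaf _)     = []
  tailSides (node l _ r) = tailSides l ++ leafSides false r
  initSides (leaf _)     = []
  initSides (node l _ r) = leafSides true l ++ initSides r

  tail-sides : ∀ t → leafSides true t ≡ true ∷ tailSides t
  tail-sides (leaf _)     = refl
  tail-sides (node l _ r) = cong (_++ leafSides false r) (tail-sides l)

  init-sides : ∀ t → leafSides false t ≡ initSides t ++ [ false ]
  init-sides (leaf _)     = refl
  init-sides (node l _ r) =
    trans (cong (leafSides true l ++_) (init-sides r))
          (sym (List.++-assoc (leafSides true l) (initSides r) [ false ]))

  length-sides : ∀ d t → length (leafSides d t) ≡ suc (#nodes t)
  length-sides d (leaf _)     = refl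
  length-sides d (node l _ r) =
    trans (List.length-++ (leafSides true l))
          (cong₂ _+_ (length-sides true l) (length-sides false r))

  take-++ : ∀ {n} (u v : List Bool) → length u ≡ n → take n (u ++ v) ≡ u
  take-++ []      v refl = refl
  take-++ (x ∷ u) v refl = cong (x ∷_) (take-++ u v refl)

  canopy-unique : ∀ t c → leafSides true t ≡ true ∷ c ++ [ false ] → canopy t ≡ c
  canopy-unique t c eq = trans (cong (take (#nodes t ∸ 1) ∘ drop 1) eq) (take-++ c _ len)
    where
    len : length c ≡ #nodes t ∸ 1
    len = begin
      length c                              ≡⟨ ℕ.m+n∸n≡m (length c) 1 ⟨
      (length c + 1) ∸ 1                    ≡⟨ cong (_∸ 1) (List.length-++ c) ⟨
      length (c ++ [ false ]) ∸ 1           ≡⟨ cong (λ w → length w ∸ 2) eq ⟨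
      length (leafSides true t) ∸ 2         ≡⟨ cong (_∸ 2) (length-sides true t) ⟩
      #nodes t ∸ 1                          ∎

  node-sides : ∀ l r → let t = node l tt r in leafSides true t ≡ true ∷ canopy t ++ [ false ]
  node-sides l r = subst (λ c → leafSides true t ≡ true ∷ c ++ [ false ])
                         (sym (canopy-unique t _ eq)) eq
    where
    t = node l tt r
    eq : leafSides true t ≡ true ∷ (tailSides l ++ initSides r) ++ [ false ]
    eq = begin
      leafSides true l ++ leafSides false r
        ≡⟨ cong₂ _++_ (tail-sides l) (init-sides r) ⟩
      true ∷ tailSides l ++ initSides r ++ [ false ]
        ≡⟨ cong (true ∷_) (List.++-assoc (tailSides l) _ _) ⟨
      true ∷ (tailSides l ++ initSides r) ++ [ false ] ∎

  sides-/ : ∀ t₀ t₁ → leafSides true (t₀ /ᵗ t₁) ≡ leafSides true t₀ ++ tailSides t₁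
  sides-/ t₀ (leaf _)     = sym (List.++-identityʳ _)
  sides-/ t₀ (node l _ r) =
    trans (cong (_++ leafSides false r) (sides-/ t₀ l))
          (List.++-assoc (leafSides true t₀) (tailSides l) _)

  sides-∖ : ∀ t₀ t₁ → leafSides false (t₀ ∖ᵗ t₁) ≡ initSides t₀ ++ leafSides false t₁
  sides-∖ (leaf _)     t₁ = refl
  sides-∖ (node l _ r) t₁ =
    trans (cong (leafSides true l ++_) (sides-∖ r t₁))
          (sym (List.++-assoc (leafSides true l) (initSides r) _))

  canopy-/ : ∀ l r l′ r′ → let t = node l tt r; t′ = node l′ tt r′ in
             canopy (t /ᵗ t′) ≡ canopy t ++ false ∷ canopy t′
  canopy-/ l r l′ r′ = canopy-unique (t /ᵗ t′) _ (begin
    leafSides true (t /ᵗ t′)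
      ≡⟨ sides-/ t t′ ⟩
    leafSides true t ++ tailSides t′
      ≡⟨ cong₂ _++_ (node-sides l r)
               (List.∷-injectiveʳ (trans (sym (tail-sides t′)) (node-sides l′ r′))) ⟩
    true ∷ (canopy t ++ [ false ]) ++ canopy t′ ++ [ false ]
      ≡⟨ cong (true ∷_) (List.++-assoc (canopy t) _ _) ⟩
    true ∷ canopy t ++ false ∷ canopy t′ ++ [ false ]
      ≡⟨ cong (true ∷_) (List.++-assoc (canopy t) _ _) ⟨
    true ∷ (canopy t ++ false ∷ canopy t′) ++ [ false ] ∎)
    where t = node l tt r; t′ = node l′ tt r′

  canopy-∖ : ∀ l r l′ r′ → let t = node l tt r; t′ = node l′ tt r′ in
             canopy (t ∖ᵗ t′) ≡ canopy t ++ true ∷ canopy t′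
  canopy-∖ l r l′ r′ = canopy-unique (t ∖ᵗ t′) _ (begin
    leafSides true (t ∖ᵗ t′)
      ≡⟨ sides-∖ t t′ ⟩
    initSides t ++ leafSides true t′
      ≡⟨ cong₂ _++_ (List.++-cancelʳ [ false ] (initSides t) (true ∷ canopy t)
                      (trans (sym (init-sides t)) (node-sides l r)))
               (node-sides l′ r′) ⟩
    true ∷ canopy t ++ true ∷ canopy t′ ++ [ false ]
      ≡⟨ cong (true ∷_) (List.++-assoc (canopy t) _ _) ⟨
    true ∷ (canopy t ++ true ∷ canopy t′) ++ [ false ] ∎)
    where t = node l tt r; t′ = node l′ tt r′

  leaf-/ : ∀ t → leaf tt /ᵗ t ≡ t
  leaf-/ (leaf _)     = refl
  leaf-/ (node l _ r) = cong (λ s → node s tt r) (leaf-/ l)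

  ∖-leaf : ∀ t → t ∖ᵗ leaf tt ≡ t
  ∖-leaf (leaf _)     = refl
  ∖-leaf (node l _ r) = cong (node l tt) (∖-leaf r)

  ¬empty-nonempty : ∀ l r → 0 ≢ #nodes (node {N = ⊤} {L = ⊤} l tt r)
  ¬empty-nonempty l r eq with () ← trans eq (ℕ.+-suc (#nodes l) _)

  twin-∖/ : ∀ t s t′ s′ → Twin t s → Twin t′ s′ → Twin (t ∖ᵗ t′) (s /ᵗ s′)
  twin-∖/ (leaf _) (leaf _) t′ s′ _ τ′ = subst (Twin t′) (sym (leaf-/ s′)) τ′
  twin-∖/ (leaf _) (node l _ r) t′ s′ (eq , _) _ = ⊥-elim (¬empty-nonempty l r eq)
  twin-∖/ (node l _ r) (leaf _) t′ s′ (eq , _) _ = ⊥-elim (¬empty-nonempty l r (sym eq))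
  twin-∖/ t@(node _ _ _) s@(node _ _ _) (leaf _) (leaf _) τ _ =
    subst (λ t → Twin t s) (sym (∖-leaf t)) τ
  twin-∖/ (node _ _ _) (node _ _ _) (leaf _) (node l _ r) _ (eq , _) =
    ⊥-elim (¬empty-nonempty l r eq)
  twin-∖/ (node _ _ _) (node _ _ _) (node l _ r) (leaf _) _ (eq , _) =
    ⊥-elim (¬empty-nonempty l r (sym eq))
  twin-∖/ t@(node l _ r) s@(node l₁ _ r₁) t′@(node l′ _ r′) s′@(node l₁′ _ r₁′) (eq , c) (eq′ , c′) =
    trans (#nodes-∖ t t′) (trans (cong₂ _+_ eq eq′) (sym (#nodes-/ s s′))) ,
    subst₂ (Pointwise _≢_) (sym (canopy-∖ l r l′ r′)) (sym (canopy-/ l₁ r₁ l₁′ r₁′))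
           (Pointwise.++⁺ c ((λ ()) ∷ c′))

  twin-sym : ∀ t s → Twin t s → Twin s t
  twin-sym t s (eq , c) = sym eq , Pointwise.symmetric (λ x≢y y≡x → x≢y (sym y≡x)) c

  twin-/∖ : ∀ t s t′ s′ → Twin t s → Twin t′ s′ → Twin (t /ᵗ t′) (s ∖ᵗ s′)
  twin-/∖ t s t′ s′ τ τ′ =
    twin-sym (s ∖ᵗ s′) (t /ᵗ t′) (twin-∖/ s t s′ t′ (twin-sym t s τ) (twin-sym t′ s′ τ′))

infixl 6 _/_ _∖_

_/_ : TwinPair → TwinPair → TwinPair
twinPair t s τ / twinPair t′ s′ τ′ =
  twinPair (t ∖ᵗ t′) (s /ᵗ s′) (Grafting.twin-∖/ t s t′ s′ τ τ′)

_∖_ : TwinPair → TwinPair → TwinPair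
twinPair t s τ ∖ twinPair t′ s′ τ′ =
  twinPair (t /ᵗ t′) (s ∖ᵗ s′) (Grafting.twin-/∖ t s t′ s′ τ τ′)

Fibre : TwinPair → 𝔖 → Set
Fibre J σ = ℙ σ ≡ trees J

fibre? : ∀ J → Decidable (Fibre J)
fibre? J σ = ℙ σ ≟² trees J

fibre-size : ∀ J σ → Fibre J σ → size σ ≡ #nodes (treeᴸ J)
fibre-size J σ ℙσ≡J = trans (sym (#nodes-ℙ σ)) (cong (#nodes ∘ proj₁) ℙσ≡J)

fibre : ∀ J → Enumeration (Fibre J)
fibre J = enumerate _≟𝔖_ (fibre? J) (permutations (#nodes (treeᴸ J)))
            λ {σ} ℙσ≡J → ∈-permutations σ (fibre-size J σ ℙσ≡J)

infix 4 _≤B_ _≤B?_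

_≤B_ : TwinPair → TwinPair → Set
J₀ ≤B J₁ = ∃₂ λ σ ν → σ ≤P ν × ℙ σ ≡ trees J₀ × ℙ ν ≡ trees J₁

_≤B?_ : ∀ J₀ J₁ → Dec (J₀ ≤B J₁)
J₀ ≤B? J₁ = map′ from to
  (any? (λ σ → any? (λ ν → (σ ≤P? ν) ×-dec fibre? J₀ σ ×-dec fibre? J₁ ν) perms) perms)
  where
  perms = permutations (#nodes (treeᴸ J₀))
  Witness : 𝔖 → 𝔖 → Set
  Witness σ ν = σ ≤P ν × Fibre J₀ σ × Fibre J₁ ν

  from : Any.Any (λ σ → Any.Any (Witness σ) perms) perms → J₀ ≤B J₁
  from outer with σ , _ , inner ← find outer with ν , _ , w ← find inner = σ , ν , w

  to : J₀ ≤B J₁ → Any.Any (λ σ → Any.Any (Witness σ) perms) perms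
  to (σ , ν , w@(σ≤ν , σ∈ , _)) =
    lose (∈-permutations σ (fibre-size J₀ σ σ∈))
      (lose (∈-permutations ν (trans (sym (≤P-size σ≤ν)) (fibre-size J₀ σ σ∈))) w)

toTwinPairs : BinaryTree × BinaryTree → List TwinPair
toTwinPairs (t , s) with twin? t s
... | yes τ = [ twinPair t s τ ]
... | no _  = []

∈-toTwinPairs : ∀ J → J ∈ toTwinPairs (trees J)
∈-toTwinPairs (twinPair t s τ) with twin? t s
... | yes _ = here refl
... | no ¬τ = ⊥-elim-irr (¬τ τ)

interval : ∀ J₀ J₁ → Enumeration (λ J → J₀ ≤B J × J ≤B J₁)
interval J₀ J₁ =
  enumerate _≟ᴶ_ (λ J → (J₀ ≤B? J) ×-dec (J ≤B? J₁))
    (concatMap (toTwinPairs ∘ ℙ) (permutations (#nodes (treeᴸ J₀)))) candidate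
  where
  candidate : ∀ {J} → J₀ ≤B J × J ≤B J₁ →
              J ∈ concatMap (toTwinPairs ∘ ℙ) (permutations (#nodes (treeᴸ J₀)))
  candidate {J} ((σ , ν , σ≤ν , σ∈ , ν∈) , _) =
    ∈-concatMap⁺ (toTwinPairs ∘ ℙ)
      (lose (∈-permutations ν (trans (sym (≤P-size σ≤ν)) (fibre-size J₀ σ σ∈)))
            (subst (λ ts → J ∈ toTwinPairs ts) (sym ν∈) (∈-toTwinPairs J)))

CharacteristicZero : ∀ {c ℓ₁ ℓ₂} → HeytingField c ℓ₁ ℓ₂ → Set ℓ₁
CharacteristicZero K = ∀ n → n ·1 ≈ 0# → n ≡ 0
  where
  open CommutativeRing
    (HeytingCommutativeRing.commutativeRing (HeytingField.heytingCommutativeRing K))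
    using (_≈_; 0#; 1#; +-rawMonoid)
  _·1 : ℕ → HeytingField.Carrier K
  n ·1 = RawMonoidDefs._×_ +-rawMonoid n 1#

module FQSymOver {c ℓ₁ ℓ₂} (K : HeytingField c ℓ₁ ℓ₂) where

  private module K = HeytingField K

  -- The vector space with basis 𝔖: formal linear combinations, compared through their
  -- coefficients on the basis.
  FQSym : Set c
  FQSym = List (K.Carrier × 𝔖)

  coefficient : FQSym → 𝔖 → K.Carrier
  coefficient []            π = K.0#
  coefficient ((k , σ) ∷ x) π = (if does (σ ≟𝔖 π) then k else K.0#) K.+ coefficient x π

  infix  4 _≈_
  infixl 7 _·_
  infixr 8 _∙_
  infix  5 ∑

  _≈_ : FQSym → FQSym → Set ℓ₁
  x ≈ y = ∀ π → coefficient x π K.≈ coefficient y π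

  𝐅 : 𝔖 → FQSym
  𝐅 σ = [ K.1# , σ ]

  _∙_ : K.Carrier → FQSym → FQSym
  k ∙ x = map (λ (k′ , σ) → k K.* k′ , σ) x

  ∑ : {P : A → Set p} → Enumeration P → (A → FQSym) → FQSym
  ∑ E f = concatMap f (Enumeration.elements E)

  syntax ∑ E (λ x → e) = ∑[ x ∈ E ] e

  _·_ : FQSym → FQSym → FQSym
  x · y = concatMap (λ (k , σ) → concatMap (λ (k′ , ν) →
            (k K.* k′) ∙ (∑[ π ∈ shiftedShuffles σ ν ] 𝐅 π)) y) x

  -- Baxter is the subalgebra of FQSym spanned by these elements, so its product is _·_.
  𝐏 : TwinPair → FQSym
  𝐏 J = ∑[ σ ∈ fibre J ] 𝐅 σ

{-# OPTIONS --safe #-}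
module Submission where

open import Defs
open import Algebra.Apartness.Bundles using (HeytingCommutativeRing; HeytingField)
open import Algebra.Bundles using (CommutativeRing)
open import Data.Bool.Base using (Bool; true; false; if_then_else_)
open import Data.List.Base
  using (List; []; _∷_; _++_; concatMap; drop; filter; foldr; iterate; length; map; reverse; take)
open import Data.List.Membership.Propositional using (_∈_)
import Data.List.Properties as List
open import Data.List.Relation.Binary.Permutation.Propositional
  using (_↭_; ↭-refl; ↭-swap; ↭-sym; ↭⇒↭ₛ)
open import Data.List.Relation.Binary.Permutation.Propositional.Properties
  using (++-comm; ++⁺ˡ; All-resp-↭; ↭-length; ↭-reverse)
import Data.List.Relation.Binary.Permutation.Setoid.Properties as PermutationSetoid
open import Data.List.Relation.Binary.Pointwise using (Pointwise; []; _∷_)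
open import Data.List.Relation.Binary.Sublist.Propositional using (_⊆_; _∷_; _∷ʳ_; from∈; lookup)
open import Data.List.Relation.Binary.Sublist.Propositional.Properties using (reverse⁺)
open import Data.List.Relation.Ternary.Interleaving using (swap)
open import Data.List.Relation.Ternary.Interleaving.Propositional
  using (Interleaving; []; consˡ; consʳ; toPermutation)
import Data.List.Relation.Ternary.Interleaving.Properties as Interleaving
open import Data.List.Relation.Unary.All as All using (All; []; _∷_)
import Data.List.Relation.Unary.All.Properties as All
open import Data.List.Relation.Unary.AllPairs using ([]; _∷_)
open import Data.List.Relation.Unary.Any using (here; there)
open import Data.List.Relation.Unary.Unique.Propositional using (Unique)
import Data.List.Relation.Unary.Unique.Propositional.Properties as Unique
open import Data.Nat.Base
  using (ℕ; zero; suc; _+_; _∸_; _≤_; _<_; s≤s; s≤s⁻¹; z<s; z≤n)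
open import Data.Nat.Properties
open import Data.Product.Base using (∃; _×_; _,_; proj₁; proj₂)
open import Data.Sum.Base using (_⊎_; inj₁; inj₂)
open import Data.Tree.Binary using (Tree; leaf; node; #nodes; mapₙ)
open import Data.Tree.Binary.Properties using (#nodes-mapₙ)
open import Data.Unit.Base using (⊤; tt)
open import Function.Base using (_∘_)
open import Level using (_⊔_)
open import Relation.Binary.Construct.Closure.ReflexiveTransitive as Star using (Star; ε; _◅_; _◅◅_)
open import Relation.Binary.PropositionalEquality
open import Relation.Nullary.Decidable
  using (Dec; yes; no; does; dec-false; dec-true; recompute; ¬?; _×-dec_)
open import Relation.Nullary.Negation using (¬_; contradiction)
open import Relation.Unary using (Decidable)

-- Both sides have coefficients 0 or 1. On the left, π occurs iff the subword σ of its small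
-- letters and the standardisation ν of its large letters satisfy ℙ σ = J₀ and ℙ ν = J₁. If so,
-- π lies between σ·ν↑ and ν↑·σ in the permutohedron, and the trees of these two are grafts.
-- Conversely, going up in the permutohedron rotates the right-to-left search tree to the right
-- and the left-to-right one to the left. Restricting a search tree to an interval of labels
-- commutes with insertion and with rotations, and it gives the same tree on both ends of the
-- interval from J₀ / J₁ to J₀ ∖ J₁. Since rotations are antisymmetric, it gives that tree
-- everywhere in between, and restricting the trees of π yields the trees of σ and ν.
--
-- For the sum on the right to see π at all, ℙ π must be a pair of twin trees: the leaf between
-- i and i + 1 hangs on the left iff i is inserted before i + 1, and the two trees insert in
-- opposite orders.

-- Search trees and leaf insertion

SearchTree : Set
SearchTree = Tree ℕ ⊤

private
  variable
    a b c i k lo hi lo′ hi′ m n x y : ℕ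
    s s′ : BinaryTree
    t t′ : SearchTree
    u v w w′ : List ℕ

insert-< : ∀ l r → x < y → insert x (node l y r) ≡ node (insert x l) y r
insert-< {x} {y} l r x<y rewrite dec-true (x <? y) x<y = refl

insert-≥ : ∀ l r → y ≤ x → insert x (node l y r) ≡ node l y (insert x r)
insert-≥ {y} {x} l r y≤x rewrite dec-false (x <? y) (≤⇒≯ y≤x) = refl

-- Rotations

-- The premise `a < b` keeps the search order at the rotated edge. It is all that insertion needs in
-- order to commute with a rotation, so no ordering invariant on the whole tree is carried along.
data Rotation : SearchTree → SearchTree → Set where
  rotate : ∀ l c r → a < b → Rotation (node (node l a c) b r) (node l a (node c b r))
  left   : ∀ r → Rotation t t′ → Rotation (node t y r) (node t′ y r)
  right  : ∀ l → Rotation t t′ → Rotation (node l y t) (node l y t′)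

infix 4 _⟶*_

_⟶*_ : SearchTree → SearchTree → Set
_⟶*_ = Star Rotation

left* : ∀ r → t ⟶* t′ → node t y r ⟶* node t′ y r
left* r = Star.gmap _ (left r)

right* : ∀ l → t ⟶* t′ → node l y t ⟶* node l y t′
right* l = Star.gmap _ (right l)

-- Since `a < b`, comparing `x` with the two rotated labels sends it into the same one of the
-- subtrees `l`, `c`, `r` before and after the rotation.
insert-rotation : ∀ x → Rotation t t′ → Rotation (insert x t) (insert x t′)
insert-rotation x (rotate {a} {b} l c r a<b) with <-≤-connex x a | <-≤-connex x b
... | inj₁ x<a | inj₁ x<b rewrite insert-< (node l a c) r x<b | insert-< l c x<a | insert-< l (node c b r) x<a =
  rotate _ _ _ a<b
... | inj₁ x<a | inj₂ b≤x = contradiction (<-trans x<a a<b) (≤⇒≯ b≤x)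
... | inj₂ a≤x | inj₁ x<b rewrite insert-< (node l a c) r x<b | insert-≥ l c a≤x | insert-≥ l (node c b r) a≤x
                                | insert-< c r x<b =
  rotate _ _ _ a<b
... | inj₂ a≤x | inj₂ b≤x rewrite insert-≥ (node l a c) r b≤x | insert-≥ l (node c b r) a≤x | insert-≥ c r b≤x =
  rotate _ _ _ a<b
insert-rotation x (left {t} {t′} {y} r s) with <-≤-connex x y
... | inj₁ x<y rewrite insert-< t r x<y | insert-< t′ r x<y = left r (insert-rotation x s)
... | inj₂ y≤x rewrite insert-≥ t r y≤x | insert-≥ t′ r y≤x = left _ s
insert-rotation x (right {t} {t′} {y} l s) with <-≤-connex x y
... | inj₁ x<y rewrite insert-< l t x<y | insert-< l t′ x<y = right _ s
... | inj₂ y≤x rewrite insert-≥ l t y≤x | insert-≥ l t′ y≤x = right l (insert-rotation x s)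

-- Both letters follow one path until a node separates them, and then the insertions commute, or
-- until they reach a common leaf, where exchanging them is one rotation.
insert-swap : ∀ t → a < b → insert a (insert b t) ⟶* insert b (insert a t)
insert-swap {a} {b} (leaf _) a<b
  rewrite insert-< {a} {b} (leaf tt) (leaf tt) a<b | insert-≥ {a} {b} (leaf tt) (leaf tt) (<⇒≤ a<b) =
  rotate _ _ _ a<b ◅ ε
insert-swap {a} {b} (node l y r) a<b with <-≤-connex a y | <-≤-connex b y
... | inj₁ a<y | inj₁ b<y
  rewrite insert-< l r b<y | insert-< l r a<y | insert-< (insert b l) r a<y | insert-< (insert a l) r b<y =
  left* r (insert-swap l a<b)
... | inj₁ a<y | inj₂ y≤b
  rewrite insert-≥ l r y≤b | insert-< l r a<y | insert-< l (insert b r) a<y | insert-≥ (insert a l) r y≤b = ε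
... | inj₂ y≤a | inj₁ b<y = contradiction (<-trans a<b b<y) (≤⇒≯ y≤a)
... | inj₂ y≤a | inj₂ y≤b
  rewrite insert-≥ l r y≤b | insert-≥ l r y≤a | insert-≥ l (insert b r) y≤a | insert-≥ l (insert a r) y≤b =
  right* l (insert-swap r a<b)

searchTree : List ℕ → SearchTree
searchTree = foldr insert (leaf tt)

swap⇒⟶* : ∀ {w w′} → Swap w w′ → searchTree w ⟶* searchTree w′
swap⇒⟶* ([]    , v , a , b , a<b , refl , refl) = insert-swap (searchTree v) a<b
swap⇒⟶* (x ∷ u , v , a , b , a<b , refl , refl) =
  Star.gmap (insert x) (insert-rotation x) (swap⇒⟶* (u , v , a , b , a<b , refl , refl))

≤P⇒⟶* : ∀ {σ ν} → σ ≤P ν → searchTree (word σ) ⟶* searchTree (word ν)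
≤P⇒⟶* = Star.concat ∘ Star.gmap (searchTree ∘ word) swap⇒⟶*

-- Inserting from left to right is inserting the reversed word from right to left. As reversal turns
-- covers upside down, the result on `searchTree` serves both trees, with opposite directions.
reverse-swap : ∀ {w w′} → Swap w w′ → Swap (reverse w′) (reverse w)
reverse-swap (u , v , a , b , a<b , refl , refl) =
  reverse v , reverse u , a , b , a<b , rev b a , rev a b
  where
  open ≡-Reasoning
  rev : ∀ a b → reverse (u ++ a ∷ b ∷ v) ≡ reverse v ++ b ∷ a ∷ reverse u
  rev a b = begin
    reverse (u ++ a ∷ b ∷ v)            ≡⟨ List.reverse-++ u (a ∷ b ∷ v) ⟩
    reverse (a ∷ b ∷ v) ++ reverse u    ≡⟨ cong (_++ reverse u) (List.reverse-++ (a ∷ b ∷ []) v) ⟩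
    (reverse v ++ b ∷ a ∷ []) ++ reverse u ≡⟨ List.++-assoc (reverse v) _ _ ⟩
    reverse v ++ b ∷ a ∷ reverse u ∎

≤P⇒reverse-⟶* : ∀ {σ ν} → σ ≤P ν → searchTree (reverse (word ν)) ⟶* searchTree (reverse (word σ))
≤P⇒reverse-⟶* ε       = ε
≤P⇒reverse-⟶* (c ◅ s) = ≤P⇒reverse-⟶* s ◅◅ swap⇒⟶* (reverse-swap c)

-- The sum over all nodes of the sizes of their right subtrees. Every rotation increases it, so
-- chains of rotations cannot close up.
rightWeight : BinaryTree → ℕ
rightWeight (leaf _)     = 0
rightWeight (node l _ r) = rightWeight l + (#nodes r + rightWeight r)

rotation-#nodes : Rotation t t′ → #nodes (shape t) ≡ #nodes (shape t′)
rotation-#nodes (rotate l c r _) = +-assoc (#nodes (shape l)) (suc (#nodes (shape c))) _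
rotation-#nodes (left r s)       = cong (_+ _) (rotation-#nodes s)
rotation-#nodes (right l s)      = cong (λ n → #nodes (shape l) + suc n) (rotation-#nodes s)

rotation-rightWeight : Rotation t t′ → rightWeight (shape t) < rightWeight (shape t′)
rotation-rightWeight (rotate l c r _) = begin-strict
  L + (C + c′) + (R + r′)               ≡⟨ +-assoc L _ _ ⟩
  L + (C + c′ + (R + r′))               ≡⟨ cong (L +_) (+-assoc C c′ _) ⟩
  -- Only the right subtree of `a` changes its size: it grows from `c` to `node c b r`.
  L + (C + (c′ + (R + r′)))             <⟨ +-monoʳ-< L (+-monoˡ-< _ (m<m+n C z<s)) ⟩
  L + (C + suc R + (c′ + (R + r′)))     ∎
  where
  open ≤-Reasoning
  L = rightWeight (shape l)
  C = #nodes (shape c)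
  c′ = rightWeight (shape c)
  R = #nodes (shape r)
  r′ = rightWeight (shape r)
rotation-rightWeight (left r s)  = +-monoˡ-< _ (rotation-rightWeight s)
rotation-rightWeight (right l s) = +-monoʳ-< (rightWeight (shape l))
  (+-mono-≤-< (≤-reflexive (rotation-#nodes s)) (rotation-rightWeight s))

⟶*-rightWeight : t ⟶* t′ → rightWeight (shape t) ≤ rightWeight (shape t′)
⟶*-rightWeight ε       = ≤-refl
⟶*-rightWeight (s ◅ p) = ≤-trans (<⇒≤ (rotation-rightWeight s)) (⟶*-rightWeight p)

⟶*-antisym : t ⟶* t′ → t′ ⟶* t → t ≡ t′
⟶*-antisym ε       _ = refl
⟶*-antisym (s ◅ p) q = contradiction
  (<-≤-trans (rotation-rightWeight s) (≤-trans (⟶*-rightWeight p) (⟶*-rightWeight q))) (<-irrefl refl)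

-- Bounds, search paths and consecutive labels

-- Strictly increasing labels in the half-open interval from lo to hi; a tree that fills its
-- interval is determined by its shape.
data Bounded : ℕ → ℕ → SearchTree → Set where
  leaf : lo ≤ hi → Bounded lo hi (leaf tt)
  node : ∀ {l r} → Bounded lo y l → Bounded (suc y) hi r → Bounded lo hi (node l y r)

bounded-≤ : Bounded lo hi t → lo ≤ hi
bounded-≤ (leaf lo≤hi) = lo≤hi
bounded-≤ (node p q)   = ≤-trans (bounded-≤ p) (<⇒≤ (bounded-≤ q))

weaken : lo′ ≤ lo → hi ≤ hi′ → Bounded lo hi t → Bounded lo′ hi′ t
weaken p q (leaf r)   = leaf (≤-trans p (≤-trans r q))
weaken p q (node s r) = node (weaken p ≤-refl s) (weaken ≤-refl q r)

-- Occurrence at a place where a search for `x` arrives. The recorded comparisons are those of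
-- `insert`, so the lemmas below follow the path without assuming that the tree is ordered.
data OnPath (x : ℕ) : SearchTree → Set where
  here  : ∀ {l r} → OnPath x (node l x r)
  left  : ∀ {l r} → x < y → OnPath x l → OnPath x (node l y r)
  right : ∀ {l r} → y < x → OnPath x r → OnPath x (node l y r)

onPath-self : ∀ x t → OnPath x (insert x t)
onPath-self x (leaf _) = here
onPath-self x (node l y r) with <-≤-connex x y
... | inj₁ x<y rewrite insert-< l r x<y = left x<y (onPath-self x l)
... | inj₂ y≤x rewrite insert-≥ l r y≤x with m≤n⇒m<n∨m≡n y≤x
...   | inj₁ y<x  = right y<x (onPath-self x r)
...   | inj₂ refl = here

onPath-insert⁺ : ∀ x → OnPath i t → OnPath i (insert x t)
onPath-insert⁺ {i} x (here {l} {r}) with <-≤-connex x i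
... | inj₁ x<y rewrite insert-< l r x<y = here
... | inj₂ y≤x rewrite insert-≥ l r y≤x = here
onPath-insert⁺ x (left {y} {l} {r} i<y p) with <-≤-connex x y
... | inj₁ x<y rewrite insert-< l r x<y = left i<y (onPath-insert⁺ x p)
... | inj₂ y≤x rewrite insert-≥ l r y≤x = left i<y p
onPath-insert⁺ x (right {y} {l} {r} y<i p) with <-≤-connex x y
... | inj₁ x<y rewrite insert-< l r x<y = right y<i p
... | inj₂ y≤x rewrite insert-≥ l r y≤x = right y<i (onPath-insert⁺ x p)

onPath-insert⁻ : ∀ x t → OnPath i (insert x t) → i ≡ x ⊎ OnPath i t
onPath-insert⁻ x (leaf _) here = inj₁ refl
onPath-insert⁻ x (node l y r) p with <-≤-connex x y
onPath-insert⁻ x (node l y r) p | inj₁ x<y rewrite insert-< l r x<y with p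
... | here        = inj₂ here
... | right y<i q = inj₂ (right y<i q)
... | left i<y q with onPath-insert⁻ x l q
...   | inj₁ eq = inj₁ eq
...   | inj₂ q′ = inj₂ (left i<y q′)
onPath-insert⁻ x (node l y r) p | inj₂ y≤x rewrite insert-≥ l r y≤x with p
... | here       = inj₂ here
... | left i<y q = inj₂ (left i<y q)
... | right y<i q with onPath-insert⁻ x r q
...   | inj₁ eq = inj₁ eq
...   | inj₂ q′ = inj₂ (right y<i q′)

-- An equal label could only be met on the search path, and there `x` would be sent to its right and
-- break strictness.
bounded-insert : lo ≤ x → x < hi → ¬ OnPath x t → Bounded lo hi t → Bounded lo hi (insert x t)
bounded-insert lo≤x x<hi _ (leaf _) = node (leaf lo≤x) (leaf x<hi)
bounded-insert {x = x} lo≤x x<hi x∉ (node {y = y} {l = l} {r = r} p q) with <-≤-connex x y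
... | inj₁ x<y rewrite insert-< l r x<y = node (bounded-insert lo≤x x<y (x∉ ∘ left x<y) p) q
... | inj₂ y≤x rewrite insert-≥ l r y≤x with m≤n⇒m<n∨m≡n y≤x
...   | inj₁ y<x  = node p (bounded-insert y<x x<hi (x∉ ∘ right y<x) q)
...   | inj₂ refl = contradiction here x∉

onPath-searchTree⁺ : x ∈ w → OnPath x (searchTree w)
onPath-searchTree⁺ {w = x ∷ w} (here refl) = onPath-self x (searchTree w)
onPath-searchTree⁺ {w = y ∷ w} (there x∈w) = onPath-insert⁺ y (onPath-searchTree⁺ x∈w)

onPath-searchTree⁻ : ∀ w → OnPath x (searchTree w) → x ∈ w
onPath-searchTree⁻ (y ∷ w) p with onPath-insert⁻ y (searchTree w) p
... | inj₁ x≡y = here x≡y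
... | inj₂ p′  = there (onPath-searchTree⁻ w p′)

¬onPath-head : Unique (x ∷ w) → ¬ OnPath x (searchTree w)
¬onPath-head (x∉w ∷ _) p = All.lookup x∉w (onPath-searchTree⁻ _ p) refl

bounded-searchTree : lo ≤ hi → All (λ x → lo ≤ x × x < hi) w → Unique w → Bounded lo hi (searchTree w)
bounded-searchTree lo≤hi []                     _              = leaf lo≤hi
bounded-searchTree lo≤hi ((lo≤x , x<hi) ∷ rest) w!@(_ ∷ rest!) =
  bounded-insert lo≤x x<hi (¬onPath-head w!) (bounded-searchTree lo≤hi rest rest!)

-- The labelling in infix order by consecutive numbers from `lo`. It carries statements about shapes
-- over to labelled trees, where restriction to an interval makes sense.
relabel : ℕ → BinaryTree → SearchTree
relabel lo (leaf _)     = leaf tt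
relabel lo (node l _ r) = node (relabel lo l) (lo + #nodes l) (relabel (suc (lo + #nodes l)) r)

shape-relabel : ∀ lo s → shape (relabel lo s) ≡ s
shape-relabel lo (leaf _)     = refl
shape-relabel lo (node l _ r) = cong₂ (λ l r → node l tt r) (shape-relabel lo l) (shape-relabel _ r)

bounded-relabel : ∀ lo s → Bounded lo (lo + #nodes s) (relabel lo s)
bounded-relabel lo (leaf _)     = leaf (m≤m+n lo 0)
bounded-relabel lo (node l _ r) = node (bounded-relabel lo l)
  (weaken ≤-refl (≤-reflexive (trans (sym (+-suc (lo + #nodes l) _)) (+-assoc lo (#nodes l) _)))
    (bounded-relabel (suc (lo + #nodes l)) r))

bounded-#nodes : Bounded lo hi t → lo + #nodes (shape t) ≤ hi
bounded-#nodes {lo} (leaf lo≤hi) = subst (_≤ _) (sym (+-identityʳ lo)) lo≤hi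
bounded-#nodes {lo} {hi} (node {y = y} {l = l} {r = r} p q) = begin
  lo + (#nodes (shape l) + suc (#nodes (shape r))) ≡⟨ +-assoc lo _ _ ⟨
  lo + #nodes (shape l) + suc (#nodes (shape r))   ≤⟨ +-monoˡ-≤ _ (bounded-#nodes p) ⟩
  y + suc (#nodes (shape r))                       ≡⟨ +-suc y _ ⟩
  suc y + #nodes (shape r)                         ≤⟨ bounded-#nodes q ⟩
  hi                                               ∎
  where open ≤-Reasoning

-- A subtree needs at least as many labels as it has nodes. When the interval has none to spare, the
-- bounds from both subtrees squeeze the root label to a single value.
relabel-shape : Bounded lo hi t → hi ≡ lo + #nodes (shape t) → t ≡ relabel lo (shape t)
relabel-shape (leaf _) _ = refl
relabel-shape {lo} {hi} (node {y = y} {l = l} {r = r} p q) hi≡ with y≡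
  where
  L = #nodes (shape l)
  R = #nodes (shape r)
  hi≡′ : hi ≡ suc (lo + L) + R
  hi≡′ = trans hi≡ (trans (sym (+-assoc lo L _)) (+-suc (lo + L) R))
  y≡ : y ≡ lo + L
  y≡ = ≤-antisym (s≤s⁻¹ (+-cancelʳ-≤ R _ _ (subst (_ ≤_) hi≡′ (bounded-#nodes q)))) (bounded-#nodes p)
... | refl = cong₂ (λ l′ r′ → node l′ (lo + #nodes (shape l)) r′) (relabel-shape p refl) (relabel-shape q hi≡′)
  where
  hi≡′ : hi ≡ suc (lo + #nodes (shape l)) + #nodes (shape r)
  hi≡′ = trans hi≡ (trans (sym (+-assoc lo _ _)) (+-suc (lo + _) _))

-- Grafts of search trees

infixl 6 _/ˢ_ _∖ˢ_

_/ˢ_ : SearchTree → SearchTree → SearchTree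
t /ˢ leaf _     = t
t /ˢ node l y r = node (t /ˢ l) y r

_∖ˢ_ : SearchTree → SearchTree → SearchTree
leaf _     ∖ˢ t = t
node l y r ∖ˢ t = node l y (r ∖ˢ t)

shape-/ : ∀ t t′ → shape (t /ˢ t′) ≡ shape t /ᵗ shape t′
shape-/ t (leaf _)     = refl
shape-/ t (node l _ r) = cong (λ l → node l tt (shape r)) (shape-/ t l)

shape-∖ : ∀ t t′ → shape (t ∖ˢ t′) ≡ shape t ∖ᵗ shape t′
shape-∖ (leaf _)     t = refl
shape-∖ (node l _ r) t = cong (node (shape l) tt) (shape-∖ r t)

relabel-/ : ∀ lo s s′ → relabel lo (s /ᵗ s′) ≡ relabel lo s /ˢ relabel (lo + #nodes s) s′
relabel-/ lo s (leaf _)     = refl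
relabel-/ lo s (node l _ r)
  rewrite Grafting.#nodes-/ s l | sym (+-assoc lo (#nodes s) (#nodes l)) | relabel-/ lo s l = refl

relabel-∖ : ∀ lo s s′ → relabel lo (s ∖ᵗ s′) ≡ relabel lo s ∖ˢ relabel (lo + #nodes s) s′
relabel-∖ lo (leaf _)     s′ = cong (λ lo → relabel lo s′) (sym (+-identityʳ lo))
relabel-∖ lo (node l _ r) s′ = cong (node _ _) (trans (relabel-∖ _ r s′) (cong (λ n → relabel (suc (lo + #nodes l)) r ∖ˢ relabel n s′)
  (trans (sym (+-suc (lo + #nodes l) _)) (+-assoc lo (#nodes l) _))))

-- A letter below all labels of `t′` runs down its left spine and enters the tree grafted there.
insert-/ : Bounded lo hi t′ → x < lo → insert x (t /ˢ t′) ≡ insert x t /ˢ t′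
insert-/ (leaf _)                   x<lo = refl
insert-/ {t = t} (node {l = l} {r} p q) x<lo =
  trans (insert-< (t /ˢ l) r (<-≤-trans x<lo (bounded-≤ p))) (cong (λ l → node l _ r) (insert-/ p x<lo))

insert-∖ : Bounded lo hi t → hi ≤ x → insert x (t ∖ˢ t′) ≡ t ∖ˢ insert x t′
insert-∖ (leaf _)                    hi≤x = refl
insert-∖ {t′ = t′} (node {l = l} {r} p q) hi≤x =
  trans (insert-≥ l (r ∖ˢ t′) (≤-trans (<⇒≤ (bounded-≤ q)) hi≤x)) (cong (node l _) (insert-∖ q hi≤x))

-- Insertion starts at the right end of the word, so the tree of `v` is built first and the smaller
-- letters of `u` gather at its leftmost leaf.
searchTree-/ : Bounded lo hi (searchTree v) → All (_< lo) u →
               searchTree (u ++ v) ≡ searchTree u /ˢ searchTree v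
searchTree-/ p []           = sym (leaf-/ˢ _)
  where
  leaf-/ˢ : ∀ t → leaf tt /ˢ t ≡ t
  leaf-/ˢ (leaf _)     = refl
  leaf-/ˢ (node l _ r) = cong (λ l → node l _ r) (leaf-/ˢ l)
searchTree-/ p (x<lo ∷ u<lo) = trans (cong (insert _) (searchTree-/ p u<lo)) (insert-/ p x<lo)

searchTree-∖ : Bounded lo hi (searchTree v) → All (hi ≤_) u →
               searchTree (u ++ v) ≡ searchTree v ∖ˢ searchTree u
searchTree-∖ {v = v} p []    = sym (∖ˢ-leaf (searchTree v))
  where
  ∖ˢ-leaf : ∀ t → t ∖ˢ leaf tt ≡ t
  ∖ˢ-leaf (leaf _)     = refl
  ∖ˢ-leaf (node l _ r) = cong (node l _) (∖ˢ-leaf r)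
searchTree-∖ p (hi≤x ∷ hi≤u) = trans (cong (insert _) (searchTree-∖ p hi≤u)) (insert-∖ p hi≤x)

-- Restriction to an interval of labels

module Restriction (lo hi : ℕ) (lo≤hi : lo ≤ hi) where

  data Position (y : ℕ) : Set where
    below  : y < lo → Position y
    inside : lo ≤ y → y < hi → Position y
    above  : hi ≤ y → Position y

  position : ∀ y → Position y
  position y with <-≤-connex y lo | <-≤-connex y hi
  ... | inj₁ y<lo | _         = below y<lo
  ... | inj₂ lo≤y | inj₁ y<hi = inside lo≤y y<hi
  ... | inj₂ _    | inj₂ hi≤y = above hi≤y

  -- In a search tree, a root outside the interval has one subtree entirely outside as well; that
  -- subtree is dropped without inspection.
  restrict : SearchTree → SearchTree
  restrict (leaf _)     = leaf tt
  restrict (node l y r) =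
    if does (y <? lo) then restrict r else
    if does (y <? hi) then node (restrict l) y (restrict r) else restrict l

  restrict-below : ∀ l r → y < lo → restrict (node l y r) ≡ restrict r
  restrict-below {y} l r y<lo rewrite dec-true (y <? lo) y<lo = refl

  restrict-inside : ∀ l r → lo ≤ y → y < hi → restrict (node l y r) ≡ node (restrict l) y (restrict r)
  restrict-inside {y} l r lo≤y y<hi
    rewrite dec-false (y <? lo) (≤⇒≯ lo≤y) | dec-true (y <? hi) y<hi = refl

  restrict-above : ∀ l r → hi ≤ y → restrict (node l y r) ≡ restrict l
  restrict-above {y} l r hi≤y
    rewrite dec-false (y <? lo) (≤⇒≯ (≤-trans lo≤hi hi≤y)) | dec-false (y <? hi) (≤⇒≯ hi≤y) = refl

  -- A node outside the interval sends `x` into the very subtree that restriction keeps.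
  restrict-insert : ∀ t → lo ≤ x → x < hi → restrict (insert x t) ≡ insert x (restrict t)
  restrict-insert (leaf _) lo≤x x<hi = restrict-inside (leaf tt) (leaf tt) lo≤x x<hi
  restrict-insert {x} (node l y r) lo≤x x<hi with <-≤-connex x y | position y
  ... | inj₁ x<y | below y<lo = contradiction (<-trans x<y y<lo) (≤⇒≯ lo≤x)
  ... | inj₁ x<y | inside lo≤y y<hi
    rewrite insert-< l r x<y | restrict-inside (insert x l) r lo≤y y<hi | restrict-inside l r lo≤y y<hi
          | insert-< (restrict l) (restrict r) x<y = cong (λ l → node l y _) (restrict-insert l lo≤x x<hi)
  ... | inj₁ x<y | above hi≤y
    rewrite insert-< l r x<y | restrict-above (insert x l) r hi≤y | restrict-above l r hi≤y =
    restrict-insert l lo≤x x<hi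
  ... | inj₂ y≤x | below y<lo
    rewrite insert-≥ l r y≤x | restrict-below l (insert x r) y<lo | restrict-below l r y<lo =
    restrict-insert r lo≤x x<hi
  ... | inj₂ y≤x | inside lo≤y y<hi
    rewrite insert-≥ l r y≤x | restrict-inside l (insert x r) lo≤y y<hi | restrict-inside l r lo≤y y<hi
          | insert-≥ (restrict l) (restrict r) y≤x = cong (node _ y) (restrict-insert r lo≤x x<hi)
  ... | inj₂ y≤x | above hi≤y = contradiction x<hi (≤⇒≯ (≤-trans hi≤y y≤x))

  Outside : ℕ → Set
  Outside x = x < lo ⊎ hi ≤ x

  -- Either `x` enters a dropped subtree, or it becomes a node outside the interval with two empty
  -- subtrees, which restricts to a leaf.
  restrict-insert-outside : ∀ t → Outside x → restrict (insert x t) ≡ restrict t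
  restrict-insert-outside (leaf _) (inj₁ x<lo) = restrict-below (leaf tt) (leaf tt) x<lo
  restrict-insert-outside (leaf _) (inj₂ hi≤x) = restrict-above (leaf tt) (leaf tt) hi≤x
  restrict-insert-outside {x} (node l y r) out with <-≤-connex x y | position y
  ... | inj₁ x<y | below y<lo
    rewrite insert-< l r x<y | restrict-below (insert x l) r y<lo | restrict-below l r y<lo = refl
  ... | inj₁ x<y | inside lo≤y y<hi
    rewrite insert-< l r x<y | restrict-inside (insert x l) r lo≤y y<hi | restrict-inside l r lo≤y y<hi =
    cong (λ l → node l y _) (restrict-insert-outside l out)
  ... | inj₁ x<y | above hi≤y
    rewrite insert-< l r x<y | restrict-above (insert x l) r hi≤y | restrict-above l r hi≤y =
    restrict-insert-outside l out
  ... | inj₂ y≤x | below y<lo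
    rewrite insert-≥ l r y≤x | restrict-below l (insert x r) y<lo | restrict-below l r y<lo =
    restrict-insert-outside r out
  ... | inj₂ y≤x | inside lo≤y y<hi
    rewrite insert-≥ l r y≤x | restrict-inside l (insert x r) lo≤y y<hi | restrict-inside l r lo≤y y<hi =
    cong (node _ y) (restrict-insert-outside r out)
  ... | inj₂ y≤x | above hi≤y
    rewrite insert-≥ l r y≤x | restrict-above l (insert x r) hi≤y | restrict-above l r hi≤y = refl

  restrict-interleaving : Interleaving u v w → All (λ x → lo ≤ x × x < hi) u → All Outside v →
                          restrict (searchTree w) ≡ searchTree u
  restrict-interleaving []        _                      _            = refl
  restrict-interleaving {w = x ∷ w} (consˡ j) ((lo≤x , x<hi) ∷ u-in) v-out        =
    trans (restrict-insert (searchTree w) lo≤x x<hi) (cong (insert _) (restrict-interleaving j u-in v-out))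
  restrict-interleaving {w = x ∷ w} (consʳ j) u-in (out ∷ v-out) =
    trans (restrict-insert-outside (searchTree w) out) (restrict-interleaving j u-in v-out)

  -- A rotation survives only if both labels at its edge lie in the interval and no node above drops
  -- it; otherwise both sides restrict to the same tree. Hence the conclusion allows zero steps.
  restrict-rotation : Rotation t t′ → restrict t ⟶* restrict t′
  restrict-rotation (rotate {a} {b} l c r a<b) with position a | position b
  ... | below a<lo | below b<lo
    rewrite restrict-below (node l a c) r b<lo | restrict-below l (node c b r) a<lo
          | restrict-below c r b<lo = ε
  ... | below a<lo | inside lo≤b b<hi
    rewrite restrict-inside (node l a c) r lo≤b b<hi | restrict-below l (node c b r) a<lo
          | restrict-below l c a<lo | restrict-inside c r lo≤b b<hi = ε
  ... | below a<lo | above hi≤b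
    rewrite restrict-above (node l a c) r hi≤b | restrict-below l (node c b r) a<lo
          | restrict-below l c a<lo | restrict-above c r hi≤b = ε
  ... | inside lo≤a a<hi | below b<lo = contradiction (<-trans a<b b<lo) (≤⇒≯ lo≤a)
  ... | inside lo≤a a<hi | inside lo≤b b<hi
    rewrite restrict-inside (node l a c) r lo≤b b<hi | restrict-inside l (node c b r) lo≤a a<hi
          | restrict-inside l c lo≤a a<hi | restrict-inside c r lo≤b b<hi = rotate _ _ _ a<b ◅ ε
  ... | inside lo≤a a<hi | above hi≤b
    rewrite restrict-above (node l a c) r hi≤b | restrict-inside l (node c b r) lo≤a a<hi
          | restrict-inside l c lo≤a a<hi | restrict-above c r hi≤b = ε
  ... | above hi≤a | _
    rewrite restrict-above (node l a c) r (≤-trans hi≤a (<⇒≤ a<b)) | restrict-above l (node c b r) hi≤a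
          | restrict-above l c hi≤a = ε
  restrict-rotation (left {t} {t′} {y} r s) with position y
  ... | below y<lo rewrite restrict-below t r y<lo | restrict-below t′ r y<lo = ε
  ... | inside lo≤y y<hi rewrite restrict-inside t r lo≤y y<hi | restrict-inside t′ r lo≤y y<hi =
    left* _ (restrict-rotation s)
  ... | above hi≤y rewrite restrict-above t r hi≤y | restrict-above t′ r hi≤y = restrict-rotation s
  restrict-rotation (right {t} {t′} {y} l s) with position y
  ... | below y<lo rewrite restrict-below l t y<lo | restrict-below l t′ y<lo = restrict-rotation s
  ... | inside lo≤y y<hi rewrite restrict-inside l t lo≤y y<hi | restrict-inside l t′ lo≤y y<hi =
    right* _ (restrict-rotation s)
  ... | above hi≤y rewrite restrict-above l t hi≤y | restrict-above l t′ hi≤y = ε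

  restrict-⟶* : t ⟶* t′ → restrict t ⟶* restrict t′
  restrict-⟶* = Star.concat ∘ Star.gmap restrict restrict-rotation

  restrict-identity : Bounded a b t → lo ≤ a → b ≤ hi → restrict t ≡ t
  restrict-identity (leaf _) _ _ = refl
  restrict-identity (node {l = l} {r} p q) lo≤a b≤hi
    rewrite restrict-inside l r (≤-trans lo≤a (bounded-≤ p)) (<-≤-trans (bounded-≤ q) b≤hi) =
    cong₂ (λ l r → node l _ r)
      (restrict-identity p lo≤a (≤-trans (<⇒≤ (bounded-≤ q)) b≤hi))
      (restrict-identity q (m≤n⇒m≤1+n (≤-trans lo≤a (bounded-≤ p))) b≤hi)

  restrict-empty-below : Bounded a b t → b ≤ lo → restrict t ≡ leaf tt
  restrict-empty-below (leaf _) _ = refl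
  restrict-empty-below (node {l = l} {r} p q) b≤lo =
    trans (restrict-below l r (<-≤-trans (bounded-≤ q) b≤lo)) (restrict-empty-below q b≤lo)

  restrict-empty-above : Bounded a b t → hi ≤ a → restrict t ≡ leaf tt
  restrict-empty-above (leaf _) _ = refl
  restrict-empty-above (node {l = l} {r} p q) hi≤a =
    trans (restrict-above l r (≤-trans hi≤a (bounded-≤ p))) (restrict-empty-above p hi≤a)

  -- Together with the three lemmas that follow, this shows that both grafts of the same two trees
  -- are cut back to the same two pieces.
  restrict-/ˡ : Bounded lo hi t → Bounded a b t′ → hi ≤ a → restrict (t /ˢ t′) ≡ t
  restrict-/ˡ p (leaf _) _ = restrict-identity p ≤-refl ≤-refl
  restrict-/ˡ {t = t} p (node {l = l} {r} q q′) hi≤a =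
    trans (restrict-above (t /ˢ l) r (≤-trans hi≤a (bounded-≤ q))) (restrict-/ˡ p q hi≤a)

  restrict-/ʳ : Bounded c lo t → Bounded a b t′ → lo ≤ a → b ≤ hi → restrict (t /ˢ t′) ≡ t′
  restrict-/ʳ p (leaf _) _ _ = restrict-empty-below p ≤-refl
  restrict-/ʳ {t = t} p (node {l = l} {r} q q′) lo≤a b≤hi
    rewrite restrict-inside (t /ˢ l) r (≤-trans lo≤a (bounded-≤ q)) (<-≤-trans (bounded-≤ q′) b≤hi) =
    cong₂ (λ l r → node l _ r)
      (restrict-/ʳ p q lo≤a (≤-trans (<⇒≤ (bounded-≤ q′)) b≤hi))
      (restrict-identity q′ (m≤n⇒m≤1+n (≤-trans lo≤a (bounded-≤ q))) b≤hi)

  restrict-∖ˡ : Bounded a b t → lo ≤ a → b ≤ hi → Bounded hi c t′ → restrict (t ∖ˢ t′) ≡ t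
  restrict-∖ˡ (leaf _) _ _ q = restrict-empty-above q ≤-refl
  restrict-∖ˡ {t′ = t′} (node {l = l} {r} p p′) lo≤a b≤hi q
    rewrite restrict-inside l (r ∖ˢ t′) (≤-trans lo≤a (bounded-≤ p)) (<-≤-trans (bounded-≤ p′) b≤hi) =
    cong₂ (λ l r → node l _ r)
      (restrict-identity p lo≤a (≤-trans (<⇒≤ (bounded-≤ p′)) b≤hi))
      (restrict-∖ˡ p′ (m≤n⇒m≤1+n (≤-trans lo≤a (bounded-≤ p))) b≤hi q)

  restrict-∖ʳ : Bounded a b t → b ≤ lo → Bounded lo hi t′ → restrict (t ∖ˢ t′) ≡ t′
  restrict-∖ʳ (leaf _) _ q = restrict-identity q ≤-refl ≤-refl
  restrict-∖ʳ {t′ = t′} (node {l = l} {r} p p′) b≤lo q =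
    trans (restrict-below l (r ∖ˢ t′) (<-≤-trans (bounded-≤ p′) b≤lo)) (restrict-∖ʳ p′ b≤lo q)

-- Twin trees

-- The side of the leaf reached by searching for a label strictly between i and i + 1.
gap : ℕ → Bool → SearchTree → Bool
gap i side (leaf _)     = side
gap i side (node l y r) = if does (i <? y) then gap i true l else gap i false r

gap-< : ∀ d l r → i < y → gap i d (node l y r) ≡ gap i true l
gap-< {i} {y} d l r i<y rewrite dec-true (i <? y) i<y = refl

gap-≥ : ∀ d l r → y ≤ i → gap i d (node l y r) ≡ gap i false r
gap-≥ {y} {i} d l r y≤i rewrite dec-false (i <? y) (≤⇒≯ y≤i) = refl

-- The searches for `i` and for the gap after it make the same comparisons, so the new node replaces
-- that leaf and has it as its right child.
gap-insert-lower : ∀ d t → gap i d (insert i t) ≡ false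
gap-insert-lower {i} d (leaf _) = gap-≥ {i = i} d (leaf tt) (leaf tt) ≤-refl
gap-insert-lower {i} d (node l y r) with <-≤-connex i y
... | inj₁ i<y rewrite insert-< l r i<y | gap-< d (insert i l) r i<y = gap-insert-lower true l
... | inj₂ y≤i rewrite insert-≥ l r y≤i | gap-≥ d l (insert i r) y≤i = gap-insert-lower false r

-- The searches for `suc i` and for the gap before it could differ only at a node labelled `suc i`.
-- Without one, the leaf becomes the left child of the new node.
gap-insert-upper : ∀ d t → ¬ OnPath (suc i) t → gap i d (insert (suc i) t) ≡ true
gap-insert-upper {i} d (leaf _) _ = gap-< {y = suc i} d (leaf tt) (leaf tt) ≤-refl
gap-insert-upper {i} d (node l y r) 1+i∉ with <-≤-connex (suc i) y
... | inj₁ 1+i<y rewrite insert-< l r 1+i<y | gap-< d (insert (suc i) l) r (<⇒≤ 1+i<y) =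
  gap-insert-upper true l (1+i∉ ∘ left 1+i<y)
... | inj₂ y≤1+i rewrite insert-≥ l r y≤1+i with m≤n⇒m<n∨m≡n y≤1+i
...   | inj₁ y<1+i rewrite gap-≥ d l (insert (suc i) r) (s≤s⁻¹ y<1+i) =
  gap-insert-upper false r (1+i∉ ∘ right y<1+i)
...   | inj₂ refl = contradiction here 1+i∉

-- At the latest at the node `suc i`, the path of `x` turns right while that of the gap turns left,
-- so the leaf in the gap is not touched.
gap-insert-above : ∀ d → OnPath (suc i) t → suc i < x → gap i d (insert x t) ≡ gap i d t
gap-insert-above {i} {x = x} d (here {l} {r}) 1+i<x
  rewrite insert-≥ l r (<⇒≤ 1+i<x) | gap-< d l (insert x r) (n<1+n i) | gap-< d l r (n<1+n i) = refl
gap-insert-above {i} {x = x} d (left {y} {l} {r} 1+i<y p) 1+i<x with <-≤-connex x y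
... | inj₁ x<y rewrite insert-< l r x<y | gap-< d (insert x l) r (<⇒≤ 1+i<y) | gap-< d l r (<⇒≤ 1+i<y) =
  gap-insert-above true p 1+i<x
... | inj₂ y≤x rewrite insert-≥ l r y≤x | gap-< d l (insert x r) (<⇒≤ 1+i<y) | gap-< d l r (<⇒≤ 1+i<y) = refl
gap-insert-above {i} {x = x} d (right {y} {l} {r} y<1+i p) 1+i<x
  rewrite insert-≥ l r (<⇒≤ (<-trans y<1+i 1+i<x)) | gap-≥ d l (insert x r) (s≤s⁻¹ y<1+i)
        | gap-≥ d l r (s≤s⁻¹ y<1+i) = gap-insert-above false p 1+i<x

gap-insert-below : ∀ d → OnPath i t → x < i → gap i d (insert x t) ≡ gap i d t
gap-insert-below {i} {x = x} d (here {l} {r}) x<i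
  rewrite insert-< l r x<i | gap-≥ {i} d (insert x l) r ≤-refl | gap-≥ {i} d l r ≤-refl = refl
gap-insert-below {i} {x = x} d (left {y} {l} {r} i<y p) x<i
  rewrite insert-< l r (<-trans x<i i<y) | gap-< d (insert x l) r i<y | gap-< d l r i<y =
  gap-insert-below true p x<i
gap-insert-below {i} {x = x} d (right {y} {l} {r} y<i p) x<i with <-≤-connex x y
... | inj₁ x<y rewrite insert-< l r x<y | gap-≥ d (insert x l) r (<⇒≤ y<i) | gap-≥ d l r (<⇒≤ y<i) = refl
... | inj₂ y≤x rewrite insert-≥ l r y≤x | gap-≥ d l (insert x r) (<⇒≤ y<i) | gap-≥ d l r (<⇒≤ y<i) =
  gap-insert-below false p x<i

gap-insert-other : ∀ d → OnPath i t → OnPath (suc i) t → i ≢ x → suc i ≢ x →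
                   gap i d (insert x t) ≡ gap i d t
gap-insert-other {i} {x = x} d p q i≢x 1+i≢x with <-≤-connex x i
... | inj₁ x<i = gap-insert-below d p x<i
... | inj₂ i≤x = gap-insert-above d q (≤∧≢⇒< (≤∧≢⇒< i≤x i≢x) 1+i≢x)

⊆⇒∈₁ : x ∷ y ∷ [] ⊆ w → x ∈ w
⊆⇒∈₁ p = lookup p (here refl)

⊆⇒∈₂ : x ∷ y ∷ [] ⊆ w → y ∈ w
⊆⇒∈₂ p = lookup p (there (here refl))

-- The head of the word is inserted last. Of `i` and `suc i`, the one occurring first in the word
-- therefore fixes the side of the leaf, and the letters before it leave that side alone.
gap-lower-first : ∀ d → Unique w → i ∷ suc i ∷ [] ⊆ w → gap i d (searchTree w) ≡ false
gap-lower-first {w = x ∷ w} d (x∉ ∷ w!) (refl ∷ _) = gap-insert-lower d (searchTree w)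
gap-lower-first {w = x ∷ w} d (x∉ ∷ w!) (_ ∷ʳ p)   = trans
  (gap-insert-other d (onPath-searchTree⁺ (⊆⇒∈₁ p)) (onPath-searchTree⁺ (⊆⇒∈₂ p))
    (≢-sym (All.lookup x∉ (⊆⇒∈₁ p))) (≢-sym (All.lookup x∉ (⊆⇒∈₂ p))))
  (gap-lower-first d w! p)

gap-upper-first : ∀ d → Unique w → suc i ∷ i ∷ [] ⊆ w → gap i d (searchTree w) ≡ true
gap-upper-first {w = x ∷ w} d x∷w!      (refl ∷ _) = gap-insert-upper d (searchTree w) (¬onPath-head x∷w!)
gap-upper-first {w = x ∷ w} d (x∉ ∷ w!) (_ ∷ʳ p)   = trans
  (gap-insert-other d (onPath-searchTree⁺ (⊆⇒∈₂ p)) (onPath-searchTree⁺ (⊆⇒∈₁ p))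
    (≢-sym (All.lookup x∉ (⊆⇒∈₂ p))) (≢-sym (All.lookup x∉ (⊆⇒∈₁ p))))
  (gap-upper-first d w! p)

order : x ∈ w → y ∈ w → x ≢ y → (x ∷ y ∷ [] ⊆ w) ⊎ (y ∷ x ∷ [] ⊆ w)
order (here refl) (here refl) x≢y = contradiction refl x≢y
order (here refl) (there y∈)  _   = inj₁ (refl ∷ from∈ y∈)
order (there x∈)  (here refl) _   = inj₂ (refl ∷ from∈ x∈)
order (there x∈)  (there y∈)  x≢y with order x∈ y∈ x≢y
... | inj₁ p = inj₁ (_ ∷ʳ p)
... | inj₂ p = inj₂ (_ ∷ʳ p)

Unique-resp-↭ : w ↭ w′ → Unique w → Unique w′
Unique-resp-↭ p = PermutationSetoid.Unique-resp-↭ (setoid ℕ) (↭⇒↭ₛ p)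

gap-reverse : ∀ d → Unique w → i ∈ w → suc i ∈ w →
              gap i d (searchTree (reverse w)) ≢ gap i d (searchTree w)
gap-reverse {w} {i} d w! i∈ 1+i∈ eq with order i∈ 1+i∈ (≢-sym 1+n≢n)
... | inj₁ p with () ← trans (sym (gap-upper-first d (Unique-resp-↭ (↭-sym (↭-reverse w)) w!) (reverse⁺ p)))
                             (trans eq (gap-lower-first d w! p))
... | inj₂ p with () ← trans (sym (gap-lower-first d (Unique-resp-↭ (↭-sym (↭-reverse w)) w!) (reverse⁺ p)))
                             (trans eq (gap-upper-first d w! p))

iterate-suc-++ : ∀ a m n → iterate suc a (m + n) ≡ iterate suc a m ++ iterate suc (a + m) n
iterate-suc-++ a zero    n = cong (λ a → iterate suc a n) (sym (+-identityʳ a))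
iterate-suc-++ a (suc m) n = cong (a ∷_)
  (trans (iterate-suc-++ (suc a) m n) (cong (λ b → iterate suc (suc a) m ++ iterate suc b n) (sym (+-suc a m))))

iterate-suc-bounds : ∀ a n → All (λ i → a ≤ i × i < a + n) (iterate suc a n)
iterate-suc-bounds a zero    = []
iterate-suc-bounds a (suc n) = (≤-refl , m<m+n a z<s) ∷
  All.map (λ (a<i , i<) → <⇒≤ a<i , <-≤-trans i< (≤-reflexive (sym (+-suc a n)))) (iterate-suc-bounds (suc a) n)

-- With labels from `suc a`, the leaves sit in the gaps `a` to `a + #nodes s`, each just after the
-- label of the same number. This makes canopies comparable position by position.
leafSides-gap : ∀ d a s →
  leafSides d s ≡ map (λ i → gap i d (relabel (suc a) s)) (iterate suc a (suc (#nodes s)))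
leafSides-gap d a (leaf _) = refl
leafSides-gap d a (node l _ r) = begin
  leafSides true l ++ leafSides false r
    ≡⟨ cong₂ _++_ (leafSides-gap true a l) (leafSides-gap false root r) ⟩
  map (λ i → gap i true tˡ) (iterate suc a (suc L)) ++ map (λ i → gap i false tʳ) (iterate suc root (suc R))
    ≡⟨ cong₂ _++_
         (List.map-cong-local (All.map (λ (_ , i<m) → sym (gap-< d tˡ tʳ (<-≤-trans i<m (≤-reflexive (+-suc a L)))))
           (iterate-suc-bounds a (suc L))))
         (List.map-cong-local (All.map (λ (m≤i , _) → sym (gap-≥ d tˡ tʳ m≤i))
           (iterate-suc-bounds root (suc R)))) ⟩
  map g (iterate suc a (suc L)) ++ map g (iterate suc root (suc R))
    ≡⟨ List.map-++ g (iterate suc a (suc L)) _ ⟨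
  map g (iterate suc a (suc L) ++ iterate suc root (suc R))
    ≡⟨ cong (λ b → map g (iterate suc a (suc L) ++ iterate suc b (suc R))) (+-suc a L) ⟨
  map g (iterate suc a (suc L) ++ iterate suc (a + suc L) (suc R))
    ≡⟨ cong (map g) (iterate-suc-++ a (suc L) (suc R)) ⟨
  map g (iterate suc a (suc L + suc R)) ∎
  where
  open ≡-Reasoning
  L = #nodes l
  R = #nodes r
  root = suc a + L
  tˡ = relabel (suc a) l
  tʳ = relabel (suc root) r
  g = λ i → gap i d (node tˡ root tʳ)

pointwise-≢ : ∀ (g h : ℕ → Bool) a m k → (∀ i → a ≤ i → i < a + m → g i ≢ h i) →
              Pointwise _≢_ (take m (map g (iterate suc a k))) (take m (map h (iterate suc a k)))
pointwise-≢ g h a zero    k       _   = []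
pointwise-≢ g h a (suc m) zero    _   = []
pointwise-≢ g h a (suc m) (suc k) g≢h = g≢h a ≤-refl (m<m+n a z<s) ∷
  pointwise-≢ g h (suc a) m k (λ i a<i i< → g≢h i (<⇒≤ a<i) (subst (i <_) (sym (+-suc a m)) i<))

twin-gaps : ∀ s s′ → #nodes s ≡ #nodes s′ →
            (∀ i → 1 ≤ i → i < #nodes s → gap i true (relabel 1 s) ≢ gap i true (relabel 1 s′)) → Twin s s′
twin-gaps s s′ eq g≢h = eq , subst₂ (Pointwise _≢_)
  (cong (take (#nodes s ∸ 1) ∘ drop 1) (sym (leafSides-gap true 0 s)))
  (cong₂ (λ n → take (n ∸ 1) ∘ drop 1) eq
    (trans (cong (λ n → map (λ i → gap i true (relabel 1 s′)) (iterate suc 0 (suc n))) eq)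
           (sym (leafSides-gap true 0 s′))))
  -- Gap `0` is the first leaf and gap `#nodes s` the last; without them the gaps `1` to
  -- `#nodes s ∸ 1` remain.
  (pointwise-≢ _ _ 1 (#nodes s ∸ 1) (#nodes s) λ i 1≤i i< → g≢h i 1≤i (<-from-pred (#nodes s) 1≤i i<))
  where
  <-from-pred : ∀ n → 1 ≤ i → i < suc (n ∸ 1) → i < n
  <-from-pred zero    1≤i i<1 = contradiction i<1 (≤⇒≯ 1≤i)
  <-from-pred (suc n) _   i<  = i<

onPath-relabel : ∀ lo s → lo ≤ i → i < lo + #nodes s → OnPath i (relabel lo s)
onPath-relabel lo (leaf _) lo≤i i< = contradiction (subst (_ <_) (+-identityʳ lo) i<) (≤⇒≯ lo≤i)
onPath-relabel {i} lo (node l _ r) lo≤i i< with <-≤-connex i (lo + #nodes l)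
... | inj₁ i<y = left i<y (onPath-relabel lo l lo≤i i<y)
... | inj₂ y≤i with m≤n⇒m<n∨m≡n y≤i
...   | inj₂ refl = here
...   | inj₁ y<i  = right y<i (onPath-relabel _ r y<i
  (subst (i <_) (trans (sym (+-assoc lo (#nodes l) _)) (+-suc (lo + #nodes l) _)) i<))

-- Tree pairs of permutations

isPermutation′ : ∀ σ → IsPermutation (word σ)
isPermutation′ (perm w p) = recompute (isPermutation? w) p

IsPermutation-resp-↭ : w ↭ w′ → IsPermutation w → IsPermutation w′
IsPermutation-resp-↭ p (bounds , w!) =
  subst (λ n → All (λ x → 1 ≤ x × x ≤ n) _) (↭-length p) (All-resp-↭ p bounds) , Unique-resp-↭ p w!

#nodes-searchTree : ∀ w → #nodes (shape (searchTree w)) ≡ length w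
#nodes-searchTree w = trans (#nodes-mapₙ _ (searchTree w)) (go w)
  where
  go : ∀ w → #nodes (searchTree w) ≡ length w
  go []      = refl
  go (x ∷ w) = trans (#nodes-insert x (searchTree w)) (cong suc (go w))

searchTree-relabel : IsPermutation w → searchTree w ≡ relabel 1 (shape (searchTree w))
searchTree-relabel {w} (bounds , w!) =
  relabel-shape (bounded-searchTree {hi = suc (length w)} (s≤s z≤n) (All.map (λ (p , q) → p , s≤s q) bounds) w!)
                (cong suc (sym (#nodes-searchTree w)))

reverse-permutation : IsPermutation w → IsPermutation (reverse w)
reverse-permutation {w} = IsPermutation-resp-↭ (↭-sym (↭-reverse w))

-- In place of a pigeonhole argument: the search tree fills its interval, so it is the consecutive
-- labelling of its shape, where each number is found by searching.
letter : IsPermutation w → 1 ≤ i → i ≤ length w → i ∈ w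
letter {w} {i} w-perm 1≤i i≤n = onPath-searchTree⁻ w (subst (OnPath i) (sym (searchTree-relabel w-perm))
  (onPath-relabel 1 (shape (searchTree w)) 1≤i (s≤s (subst (i ≤_) (sym (#nodes-searchTree w)) i≤n))))

-- `ℙ` on plain words, with the left-to-right insertion expressed by reversal, so that it also
-- applies to shifted words and subwords.
treePair : List ℕ → BinaryTree × BinaryTree
treePair w = shape (searchTree (reverse w)) , shape (searchTree w)

ℙ≡treePair : ∀ σ → ℙ σ ≡ treePair (word σ)
ℙ≡treePair σ = cong (λ t → shape t , shape (searchTree (word σ))) (sym (List.reverse-foldr insert (leaf tt) (word σ)))

treePair-twin : IsPermutation w → let s , s′ = treePair w in Twin s s′
treePair-twin {w} w-perm@(_ , w!) = twin-gaps sᴸ sᴿ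
  (trans (#nodes-searchTree (reverse w)) (trans (List.length-reverse w) (sym (#nodes-searchTree w))))
  λ i 1≤i i<n → subst₂ (λ t t′ → gap i true t ≢ gap i true t′)
    (searchTree-relabel (reverse-permutation w-perm)) (searchTree-relabel w-perm)
    (gap-reverse true w! (letter w-perm 1≤i (<⇒≤ (n≡ i<n))) (letter w-perm (s≤s z≤n) (n≡ i<n)))
  where
  sᴸ = shape (searchTree (reverse w))
  sᴿ = shape (searchTree w)
  n≡ : ∀ {i} → i < #nodes sᴸ → i < length w
  n≡ = subst (_ <_) (trans (#nodes-searchTree (reverse w)) (List.length-reverse w))

shape-shift : ∀ k w → shape (searchTree (map (k +_) w)) ≡ shape (searchTree w)
shape-shift k w = trans (cong shape (searchTree-shift w)) (shape-mapₙ (searchTree w))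
  where
  insert-shift : ∀ x t → insert (k + x) (mapₙ (k +_) t) ≡ mapₙ (k +_) (insert x t)
  insert-shift x (leaf _) = refl
  insert-shift x (node l y r) with <-≤-connex x y
  ... | inj₁ x<y rewrite insert-< l r x<y =
    trans (insert-< (mapₙ (k +_) l) (mapₙ (k +_) r) (+-monoʳ-< k x<y)) (cong (λ l → node l _ _) (insert-shift x l))
  ... | inj₂ y≤x rewrite insert-≥ l r y≤x =
    trans (insert-≥ (mapₙ (k +_) l) (mapₙ (k +_) r) (+-monoʳ-≤ k y≤x)) (cong (node _ _) (insert-shift x r))
  searchTree-shift : ∀ w → searchTree (map (k +_) w) ≡ mapₙ (k +_) (searchTree w)
  searchTree-shift []      = refl
  searchTree-shift (x ∷ w) = trans (cong (insert (k + x)) (searchTree-shift w)) (insert-shift x (searchTree w))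
  shape-mapₙ : ∀ t → shape (mapₙ (k +_) t) ≡ shape t
  shape-mapₙ (leaf _)     = refl
  shape-mapₙ (node l _ r) = cong₂ (λ l r → node l tt r) (shape-mapₙ l) (shape-mapₙ r)

treePair-shift : ∀ k w → treePair (map (k +_) w) ≡ treePair w
treePair-shift k w = cong₂ _,_
  (trans (cong (shape ∘ searchTree) (sym (List.reverse-map (k +_) w))) (shape-shift k (reverse w)))
  (shape-shift k w)

-- Shuffles and the permutohedron

infix 4 _≤ʷ_

_≤ʷ_ : List ℕ → List ℕ → Set
_≤ʷ_ = Star Swap

swap-∷ : ∀ x → Swap w w′ → Swap (x ∷ w) (x ∷ w′)
swap-∷ x (u , v , a , b , a<b , eq , eq′) = x ∷ u , v , a , b , a<b , cong (x ∷_) eq , cong (x ∷_) eq′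

∷-≤ʷ : ∀ x → w ≤ʷ w′ → x ∷ w ≤ʷ x ∷ w′
∷-≤ʷ x = Star.gmap (x ∷_) (swap-∷ x)

moveLeft : All (_< y) u → u ++ y ∷ v ≤ʷ y ∷ u ++ v
moveLeft []                          = ε
moveLeft {y} {x ∷ u} {v} (x<y ∷ u<y) =
  ∷-≤ʷ x (moveLeft u<y) ◅◅ ([] , u ++ v , x , y , x<y , refl , refl) ◅ ε

moveRight : All (x <_) v → x ∷ v ++ u ≤ʷ v ++ x ∷ u
moveRight []                          = ε
moveRight {x} {y ∷ v} {u} (x<y ∷ x<v) =
  ([] , v ++ u , x , y , x<y , refl , refl) ◅ ∷-≤ʷ y (moveRight x<v)

-- A large letter at the head of the shuffle is moved left over all remaining small letters, each
-- exchange being a cover. The dual lemma moves small letters to the right.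
++-≤ʷ-shuffle : Interleaving u v w → All (_< c) u → All (c ≤_) v → u ++ v ≤ʷ w
++-≤ʷ-shuffle []        _           _           = ε
++-≤ʷ-shuffle (consˡ j) (_ ∷ u<c)   c≤v         = ∷-≤ʷ _ (++-≤ʷ-shuffle j u<c c≤v)
++-≤ʷ-shuffle (consʳ j) u<c         (c≤y ∷ c≤v) =
  moveLeft (All.map (λ x<c → <-≤-trans x<c c≤y) u<c) ◅◅ ∷-≤ʷ _ (++-≤ʷ-shuffle j u<c c≤v)

shuffle-≤ʷ-++ : Interleaving u v w → All (_< c) u → All (c ≤_) v → w ≤ʷ v ++ u
shuffle-≤ʷ-++ []        _           _         = ε
shuffle-≤ʷ-++ (consʳ j) u<c         (_ ∷ c≤v) = ∷-≤ʷ _ (shuffle-≤ʷ-++ j u<c c≤v)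
shuffle-≤ʷ-++ (consˡ j) (x<c ∷ u<c) c≤v       =
  ∷-≤ʷ _ (shuffle-≤ʷ-++ j u<c c≤v) ◅◅ moveRight (All.map (<-≤-trans x<c) c≤v)

swap⇒↭ : Swap w w′ → w ↭ w′
swap⇒↭ (u , v , a , b , _ , refl , refl) = ++⁺ˡ u (↭-swap a b ↭-refl)

≤ʷ⇒≤P : .(p : IsPermutation w) .(p′ : IsPermutation w′) → w ≤ʷ w′ → perm w p ≤P perm w′ p′
≤ʷ⇒≤P p p′ ε       = ε
≤ʷ⇒≤P p p′ (s ◅ q) = s ◅ ≤ʷ⇒≤P (IsPermutation-resp-↭ (swap⇒↭ s) p) p′ q

-- Trees of concatenated words

Within : ℕ → ℕ → List ℕ → Set
Within lo hi w = All (λ x → lo ≤ x × x < hi) w × Unique w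

within-reverse : Within lo hi w → Within lo hi (reverse w)
within-reverse {w = w} (bounds , w!) =
  All-resp-↭ (↭-sym (↭-reverse w)) bounds , Unique-resp-↭ (↭-sym (↭-reverse w)) w!

shape-searchTree-/ : b ≤ c → Within a b u → Within b c v →
                     shape (searchTree (u ++ v)) ≡ shape (searchTree u) /ᵗ shape (searchTree v)
shape-searchTree-/ {u = u} {v} b≤c (u-bounds , _) (v-bounds , v!) = trans
  (cong shape (searchTree-/ {v = v} {u = u} (bounded-searchTree b≤c v-bounds v!) (All.map proj₂ u-bounds)))
  (shape-/ (searchTree u) (searchTree v))

shape-searchTree-∖ : a ≤ b → Within a b u → Within b c v →
                     shape (searchTree (v ++ u)) ≡ shape (searchTree u) ∖ᵗ shape (searchTree v)
shape-searchTree-∖ {u = u} {v = v} a≤b (u-bounds , u!) (v-bounds , _) = trans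
  (cong shape (searchTree-∖ {v = u} {u = v} (bounded-searchTree a≤b u-bounds u!) (All.map proj₁ v-bounds)))
  (shape-∖ (searchTree u) (searchTree v))

-- The right tree starts from `v` and receives the smaller `u` at its leftmost leaf; the left tree
-- starts from `u` and receives the larger `v` at its rightmost leaf. Hence the opposite grafts in
-- the two components.
treePair-++ : a ≤ b → b ≤ c → Within a b u → Within b c v →
  treePair (u ++ v) ≡ (proj₁ (treePair u) ∖ᵗ proj₁ (treePair v) , proj₂ (treePair u) /ᵗ proj₂ (treePair v))
treePair-++ {u = u} {v = v} a≤b b≤c u-in v-in = cong₂ _,_
  (trans (cong (shape ∘ searchTree) (List.reverse-++ u v))
         (shape-searchTree-∖ a≤b (within-reverse u-in) (within-reverse v-in)))
  (shape-searchTree-/ b≤c u-in v-in)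

treePair-++-flipped : a ≤ b → b ≤ c → Within a b u → Within b c v →
  treePair (v ++ u) ≡ (proj₁ (treePair u) /ᵗ proj₁ (treePair v) , proj₂ (treePair u) ∖ᵗ proj₂ (treePair v))
treePair-++-flipped {u = u} {v = v} a≤b b≤c u-in v-in = cong₂ _,_
  (trans (cong (shape ∘ searchTree) (List.reverse-++ v u))
         (shape-searchTree-/ b≤c (within-reverse u-in) (within-reverse v-in)))
  (shape-searchTree-∖ a≤b u-in v-in)

permutation-within : ∀ σ → Within 1 (suc (size σ)) (word σ)
permutation-within σ with bounds , w! ← isPermutation′ σ = All.map (λ (p , q) → p , s≤s q) bounds , w!

shift-within : ∀ k → Within 1 (suc n) w → Within (suc k) (suc (k + n)) (map (k +_) w)
shift-within {n} k (bounds , w!) =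
  All.map⁺ (All.map (λ (p , q) → ≤-trans (≤-reflexive (+-comm 1 k)) (+-monoʳ-≤ k p) ,
                                 <-≤-trans (+-monoʳ-< k q) (≤-reflexive (+-suc k n))) bounds) ,
  Unique.map⁺ (+-cancelˡ-≡ k _ _) w!

fibre-treePair : ∀ J σ → Fibre J σ → treePair (word σ) ≡ trees J
fibre-treePair J σ ℙσ≡J = trans (sym (ℙ≡treePair σ)) ℙσ≡J

-- The witnesses are `π` itself and the two concatenations of `σʷ` and `νʷ`, which are the least and
-- the greatest shifted shuffle.
shuffle⇒interval : ∀ J₀ J₁ J σ ν π → Fibre J₀ σ → Fibre J₁ ν → Fibre J π → ShiftedShuffle σ ν π →
                   J₀ / J₁ ≤B J × J ≤B J₀ ∖ J₁
shuffle⇒interval J₀ J₁ J σ ν π σ∈ ν∈ π∈ j =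
  ( perm (σʷ ++ νʷ) σνʷ-perm , π
  , ≤ʷ⇒≤P σνʷ-perm π-perm (++-≤ʷ-shuffle j σʷ< ≤νʷ)
  , trans (ℙ≡treePair (perm (σʷ ++ νʷ) σνʷ-perm)) (trans (treePair-++ (s≤s z≤n) (s≤s (m≤m+n _ _)) σʷ-in νʷ-in)
      (cong₂ _,_ (cong₂ _∖ᵗ_ (cong proj₁ tu) (cong proj₁ tv)) (cong₂ _/ᵗ_ (cong proj₂ tu) (cong proj₂ tv))))
  , π∈ ) ,
  ( π , perm (νʷ ++ σʷ) νσʷ-perm
  , ≤ʷ⇒≤P π-perm νσʷ-perm (shuffle-≤ʷ-++ j σʷ< ≤νʷ)
  , π∈
  , trans (ℙ≡treePair (perm (νʷ ++ σʷ) νσʷ-perm)) (trans (treePair-++-flipped (s≤s z≤n) (s≤s (m≤m+n _ _)) σʷ-in νʷ-in)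
      (cong₂ _,_ (cong₂ _/ᵗ_ (cong proj₁ tu) (cong proj₁ tv)) (cong₂ _∖ᵗ_ (cong proj₂ tu) (cong proj₂ tv)))) )
  where
  σʷ = word σ
  νʷ = map (size σ +_) (word ν)
  σʷ-in = permutation-within σ
  νʷ-in : Within (suc (size σ)) (suc (size σ + size ν)) νʷ
  νʷ-in = shift-within (size σ) (permutation-within ν)
  σʷ< : All (_< suc (size σ)) σʷ
  σʷ< = All.map proj₂ (proj₁ σʷ-in)
  ≤νʷ : All (suc (size σ) ≤_) νʷ
  ≤νʷ = All.map proj₁ (proj₁ νʷ-in)
  π-perm = isPermutation′ π
  σνʷ-perm : IsPermutation (σʷ ++ νʷ)
  σνʷ-perm = IsPermutation-resp-↭ (toPermutation j) π-perm
  νσʷ-perm : IsPermutation (νʷ ++ σʷ)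
  νσʷ-perm = IsPermutation-resp-↭ (++-comm σʷ νʷ) σνʷ-perm
  tu : treePair σʷ ≡ trees J₀
  tu = fibre-treePair J₀ σ σ∈
  tv : treePair νʷ ≡ trees J₁
  tv = trans (treePair-shift (size σ) (word ν)) (fibre-treePair J₁ ν ν∈)

-- Recovering the two factors by restriction

module Split (n₀ n₁ : ℕ) where

  module Lower = Restriction 1 (suc n₀) (s≤s z≤n)
  module Upper = Restriction (suc n₀) (suc (n₀ + n₁)) (s≤s (m≤m+n n₀ n₁))

  squeeze : ∀ {t₁ t₂} → t₁ ⟶* t → t ⟶* t₂ → t₁ ≡ t′ → t₂ ≡ t′ → t ≡ t′
  squeeze p q refl refl = ⟶*-antisym q p

  -- Restriction preserves chains of rotations and both ends have the same restrictions, so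
  -- antisymmetry fixes everything between them.
  restrict-between : ∀ s s′ → #nodes s ≡ n₀ → #nodes s′ ≡ n₁ →
                     relabel 1 (s /ᵗ s′) ⟶* t → t ⟶* relabel 1 (s ∖ᵗ s′) →
                     Lower.restrict t ≡ relabel 1 s × Upper.restrict t ≡ relabel (suc n₀) s′
  restrict-between s s′ refl refl p q rewrite relabel-/ 1 s s′ | relabel-∖ 1 s s′ =
    squeeze (Lower.restrict-⟶* p) (Lower.restrict-⟶* q)
      (Lower.restrict-/ˡ low high ≤-refl) (Lower.restrict-∖ˡ low ≤-refl ≤-refl high) ,
    squeeze (Upper.restrict-⟶* p) (Upper.restrict-⟶* q)
      (Upper.restrict-/ʳ low high ≤-refl ≤-refl) (Upper.restrict-∖ʳ low ≤-refl high)
    where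
    low = bounded-relabel 1 s
    high = bounded-relabel (suc (#nodes s)) s′

  restrict-shuffle : Interleaving u v w → All (λ x → 1 ≤ x × x < suc n₀) u →
                     All (λ x → suc n₀ ≤ x × x < suc (n₀ + n₁)) v →
                     Lower.restrict (searchTree w) ≡ searchTree u × Upper.restrict (searchTree w) ≡ searchTree v
  restrict-shuffle j u-in v-in =
    Lower.restrict-interleaving j u-in (All.map (inj₂ ∘ proj₁) v-in) ,
    Upper.restrict-interleaving (swap j) v-in (All.map (inj₁ ∘ proj₂) u-in)

interleaving-filter : ∀ {ℓ} {P : ℕ → Set ℓ} (P? : Decidable P) w →
                      Interleaving (filter P? w) (filter (¬? ∘ P?) w) w
interleaving-filter P? []      = []
interleaving-filter P? (x ∷ w) with P? x
... | yes _ = consˡ (interleaving-filter P? w)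
... | no  _ = consʳ (interleaving-filter P? w)

map-+-∸ : ∀ k → All (k ≤_) w → map (k +_) (map (_∸ k) w) ≡ w
map-+-∸ k []          = refl
map-+-∸ k (k≤x ∷ k≤w) = cong₂ _∷_ (m+[n∸m]≡n k≤x) (map-+-∸ k k≤w)

#nodes-treeᴿ : ∀ J → #nodes (treeᴿ J) ≡ #nodes (treeᴸ J)
#nodes-treeᴿ (twinPair t s τ) = sym (proj₁ (recompute (twin? t s) τ))

fibre-searchTree : ∀ J σ → Fibre J σ →
  searchTree (reverse (word σ)) ≡ relabel 1 (treeᴸ J) × searchTree (word σ) ≡ relabel 1 (treeᴿ J)
fibre-searchTree J σ σ∈ =
  trans (searchTree-relabel (reverse-permutation (isPermutation′ σ)))
        (cong (relabel 1 ∘ proj₁) (fibre-treePair J σ σ∈)) ,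
  trans (searchTree-relabel (isPermutation′ σ)) (cong (relabel 1 ∘ proj₂) (fibre-treePair J σ σ∈))

-- The factors are the small letters of `π` and its large letters shifted down. Their trees are
-- restrictions of the trees of `π`, which `restrict-between` computes from `J₀` and `J₁`.
interval⇒shuffle : ∀ J₀ J₁ J π → J₀ / J₁ ≤B J → J ≤B J₀ ∖ J₁ → Fibre J π →
                   ∃ λ σ → Fibre J₀ σ × (∃ λ ν → Fibre J₁ ν × ShiftedShuffle σ ν π)
interval⇒shuffle J₀ J₁ J π (σ₀ , π₀ , σ₀≤π₀ , σ₀∈ , π₀∈) (π₁ , σ₁ , π₁≤σ₁ , π₁∈ , σ₁∈) π∈ =
  σ , trans (ℙ≡treePair σ) (cong₂ _,_ (shape≡ (trans (sym (proj₁ wordsᴸ)) (proj₁ restrᴸ)))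
                                      (shape≡ (trans (sym (proj₁ wordsᴿ)) (proj₁ restrᴿ)))) ,
  ν , trans (ℙ≡treePair ν) (trans (sym (treePair-shift n₀ large∸n₀)) (trans (cong treePair large≡)
        (cong₂ _,_ (shape≡ (trans (sym (proj₂ wordsᴸ)) (proj₂ restrᴸ)))
                   (shape≡ (trans (sym (proj₂ wordsᴿ)) (proj₂ restrᴿ)))))) ,
  -- The shift in `ShiftedShuffle` is by `size σ`, which is `n₀` only through `length-small`.
  subst (λ w → Interleaving small w (word π))
    (trans (sym large≡) (cong (λ n → map (n +_) large∸n₀) (sym length-small))) j
  where
  n₀ = #nodes (treeᴸ J₀)
  n₁ = #nodes (treeᴸ J₁)
  open Split n₀ n₁

  T = searchTree ∘ word
  Tʳ = searchTree ∘ reverse ∘ word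

  -- The hypotheses compare `π₀` and `π₁`, not `π`, with the ends. All members of a fibre share
  -- their labelled trees, so the chains of rotations carry over to `π`.
  fibre-connected : ∀ {σ ν} → Fibre J σ → Fibre J ν → Tʳ σ ≡ Tʳ ν × T σ ≡ T ν
  fibre-connected {σ} {ν} σ∈ ν∈ =
    trans (proj₁ (fibre-searchTree J σ σ∈)) (sym (proj₁ (fibre-searchTree J ν ν∈))) ,
    trans (proj₂ (fibre-searchTree J σ σ∈)) (sym (proj₂ (fibre-searchTree J ν ν∈)))

  restrᴿ : Lower.restrict (T π) ≡ relabel 1 (treeᴿ J₀) × Upper.restrict (T π) ≡ relabel (suc n₀) (treeᴿ J₁)
  restrᴿ = restrict-between (treeᴿ J₀) (treeᴿ J₁) (#nodes-treeᴿ J₀) (#nodes-treeᴿ J₁)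
    (subst₂ _⟶*_ (proj₂ (fibre-searchTree (J₀ / J₁) σ₀ σ₀∈)) (proj₂ (fibre-connected {π₀} {π} π₀∈ π∈)) (≤P⇒⟶* σ₀≤π₀))
    (subst₂ _⟶*_ (proj₂ (fibre-connected {π₁} {π} π₁∈ π∈)) (proj₂ (fibre-searchTree (J₀ ∖ J₁) σ₁ σ₁∈)) (≤P⇒⟶* π₁≤σ₁))

  -- Left trees rotate in the opposite direction, and the left tree of `J₀ ∖ J₁` is the `_/ᵗ_`
  -- graft, so the two ends trade places.
  restrᴸ : Lower.restrict (Tʳ π) ≡ relabel 1 (treeᴸ J₀) × Upper.restrict (Tʳ π) ≡ relabel (suc n₀) (treeᴸ J₁)
  restrᴸ = restrict-between (treeᴸ J₀) (treeᴸ J₁) refl refl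
    (subst₂ _⟶*_ (proj₁ (fibre-searchTree (J₀ ∖ J₁) σ₁ σ₁∈)) (proj₁ (fibre-connected {π₁} {π} π₁∈ π∈)) (≤P⇒reverse-⟶* π₁≤σ₁))
    (subst₂ _⟶*_ (proj₁ (fibre-connected {π₀} {π} π₀∈ π∈)) (proj₁ (fibre-searchTree (J₀ / J₁) σ₀ σ₀∈)) (≤P⇒reverse-⟶* σ₀≤π₀))

  size-π : size π ≡ n₀ + n₁
  size-π = begin
    size π            ≡⟨ fibre-size J π π∈ ⟩
    #nodes (treeᴸ J)  ≡⟨ fibre-size J π₀ π₀∈ ⟨
    size π₀           ≡⟨ ≤P-size σ₀≤π₀ ⟨
    size σ₀           ≡⟨ fibre-size (J₀ / J₁) σ₀ σ₀∈ ⟩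
    #nodes (treeᴸ J₀ ∖ᵗ treeᴸ J₁) ≡⟨ Grafting.#nodes-∖ (treeᴸ J₀) (treeᴸ J₁) ⟩
    n₀ + n₁           ∎
    where open ≡-Reasoning

  small? = _<? suc n₀
  small = filter small? (word π)
  large = filter (¬? ∘ small?) (word π)
  large∸n₀ = map (_∸ n₀) large

  j : Interleaving small large (word π)
  j = interleaving-filter small? (word π)

  π-in : All (λ x → 1 ≤ x × x < suc (n₀ + n₁)) (word π)
  π-in = subst (λ n → All (λ x → 1 ≤ x × x < suc n) (word π)) size-π (proj₁ (permutation-within π))

  π! : Unique (word π)
  π! = proj₂ (permutation-within π)

  small-in : All (λ x → 1 ≤ x × x < suc n₀) small
  small-in = All.zip (All.map proj₁ (All.filter⁺ small? π-in) , All.all-filter small? (word π))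

  large-in : All (λ x → suc n₀ ≤ x × x < suc (n₀ + n₁)) large
  large-in = All.zip (All.map ≮⇒≥ (All.all-filter (¬? ∘ small?) (word π)) ,
                      All.map proj₂ (All.filter⁺ (¬? ∘ small?) π-in))

  wordsᴿ = restrict-shuffle j small-in large-in
  wordsᴸ = restrict-shuffle (Interleaving.reverse⁺ j)
    (All-resp-↭ (↭-sym (↭-reverse small)) small-in) (All-resp-↭ (↭-sym (↭-reverse large)) large-in)

  shape≡ : ∀ {t lo s} → t ≡ relabel lo s → shape t ≡ s
  shape≡ {lo = lo} {s} eq = trans (cong shape eq) (shape-relabel lo s)

  large≡ : map (n₀ +_) large∸n₀ ≡ large
  large≡ = map-+-∸ n₀ (All.map (<⇒≤ ∘ proj₁) large-in)

  -- Read off from the tree of `small`, whose shape is already known, instead of counting letters of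
  -- `π`.
  length-small : length small ≡ n₀
  length-small = trans (sym (#nodes-searchTree small))
    (trans (cong #nodes (shape≡ (trans (sym (proj₁ wordsᴿ)) (proj₁ restrᴿ)))) (#nodes-treeᴿ J₀))

  length-large : length large∸n₀ ≡ n₁
  length-large = trans (List.length-map (_∸ n₀) large) (trans (sym (#nodes-searchTree large))
    (trans (cong #nodes (shape≡ (trans (sym (proj₂ wordsᴿ)) (proj₂ restrᴿ)))) (#nodes-treeᴿ J₁)))

  σ : 𝔖
  σ = perm small (subst (λ n → All (λ x → 1 ≤ x × x ≤ n) small) (sym length-small)
                (All.map (λ (p , q) → p , s≤s⁻¹ q) small-in) ,
              Unique.filter⁺ small? π!)

  ν : 𝔖
  ν = perm large∸n₀ (subst (λ n → All (λ x → 1 ≤ x × x ≤ n) large∸n₀) (sym length-large)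
                 (All.map⁺ (All.map (λ (p , q) → m<n⇒0<n∸m p , m≤n+o⇒m∸n≤o _ n₀ (s≤s⁻¹ q)) large-in)) ,
               Unique.map⁻ (subst Unique (sym large≡) (Unique.filter⁺ (¬? ∘ small?) π!)))

-- Uniqueness of the factors of a shuffle

interleaving-unique : ∀ {u v u′ v′} → Interleaving u v w → Interleaving u′ v′ w →
                      All (_< c) u → All (c ≤_) v → All (_< c) u′ → All (c ≤_) v′ → u ≡ u′ × v ≡ v′
interleaving-unique []        []         _         _         _          _          = refl , refl
interleaving-unique (consˡ i) (consˡ j)  (_ ∷ p)   q         (_ ∷ p′)   q′
  with refl , refl ← interleaving-unique i j p q p′ q′ = refl , refl
interleaving-unique (consˡ _) (consʳ _)  (x<c ∷ _) _         _          (c≤x ∷ _)  = contradiction x<c (≤⇒≯ c≤x)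
interleaving-unique (consʳ _) (consˡ _)  _         (c≤x ∷ _) (x<c ∷ _)  _          = contradiction x<c (≤⇒≯ c≤x)
interleaving-unique (consʳ i) (consʳ j)  p         (_ ∷ q)   p′         (_ ∷ q′)
  with refl , refl ← interleaving-unique i j p q p′ q′ = refl , refl

word-injective : ∀ {σ ν} → word σ ≡ word ν → σ ≡ ν
word-injective refl = refl

-- Equal sizes give both shuffles one threshold, which tells for each letter of `π` the word it
-- comes from. This keeps the coefficients of the product at 0 or 1.
shuffle-unique : ∀ {σ ν σ′ ν′ π} → size σ ≡ size σ′ → ShiftedShuffle σ ν π → ShiftedShuffle σ′ ν′ π →
                 σ ≡ σ′ × ν ≡ ν′
shuffle-unique {σ} {ν} {σ′} {ν′} {π} eq j j′ =
  word-injective (proj₁ words≡) ,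
  word-injective (List.map-injective (λ {x} {y} → +-cancelˡ-≡ (size σ) x y)
    (trans (proj₂ words≡) (cong (λ n → map (n +_) (word ν′)) (sym eq))))
  where
  small : ∀ σ → All (_< suc (size σ)) (word σ)
  small σ = All.map proj₂ (proj₁ (permutation-within σ))
  large : ∀ k ν → All (suc k ≤_) (map (k +_) (word ν))
  large k ν = All.map proj₁ (proj₁ (shift-within k (permutation-within ν)))
  words≡ = interleaving-unique j j′ (small σ) (large (size σ) ν)
    (subst (λ n → All (_< suc n) (word σ′)) (sym eq) (small σ′))
    (subst (λ n → All (suc n ≤_) (map (size σ′ +_) (word ν′))) (sym eq) (large (size σ′) ν′))

trees-injective : ∀ {J J′} → trees J ≡ trees J′ → J ≡ J′
trees-injective refl = refl

-- The only index whose fibre contains `π`.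
twinTrees : 𝔖 → TwinPair
twinTrees π = twinPair (proj₁ (treePair (word π))) (proj₂ (treePair (word π))) (treePair-twin (isPermutation′ π))

-- Coefficients

module _ {c ℓ₁ ℓ₂} (K : HeytingField c ℓ₁ ℓ₂) where

  open FQSymOver K
  private
    module K = CommutativeRing
      (HeytingCommutativeRing.commutativeRing (HeytingField.heytingCommutativeRing K))

  coefficient-++ : ∀ x y π → coefficient (x ++ y) π K.≈ coefficient x π K.+ coefficient y π
  coefficient-++ []            y π = K.sym (K.+-identityˡ _)
  coefficient-++ ((k , σ) ∷ x) y π = K.trans (K.+-congˡ (coefficient-++ x y π)) (K.sym (K.+-assoc _ _ _))

  coefficient-∙ : ∀ k x π → coefficient (k ∙ x) π K.≈ k K.* coefficient x π
  coefficient-∙ k []             π = K.sym (K.zeroʳ k)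
  coefficient-∙ k ((k′ , σ) ∷ x) π =
    K.trans (K.+-cong (head (does (σ ≟𝔖 π))) (coefficient-∙ k x π)) (K.sym (K.distribˡ k _ _))
    where
    head : ∀ d → (if d then k K.* k′ else K.0#) K.≈ k K.* (if d then k′ else K.0#)
    head true  = K.refl
    head false = K.sym (K.zeroʳ k)

  -- The coefficient of `π` in `x` is the truth value of `Q`. Two implications express this without
  -- asking for a decision of `Q`.
  record Indicates {q} (π : 𝔖) (x : FQSym) (Q : Set q) : Set (ℓ₁ ⊔ q) where
    constructor _,_
    field
      coefficient≈1 : Q → coefficient x π K.≈ K.1#
      coefficient≈0 : ¬ Q → coefficient x π K.≈ K.0#

  open Indicates

  module _ {π : 𝔖} where

    indicates-⇔ : ∀ {p q} {P : Set p} {Q : Set q} {x} → (P → Q) → (Q → P) → Indicates π x P → Indicates π x Q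
    indicates-⇔ P⇒Q Q⇒P (holds , fails) = holds ∘ Q⇒P , λ ¬Q → fails (¬Q ∘ P⇒Q)

    indicates-𝐅 : ∀ σ → Indicates π (𝐅 σ) (σ ≡ π)
    indicates-𝐅 σ = let holds , fails = truth (σ ≟𝔖 π) in holds , fails
      where
      truth : ∀ {q} {Q : Set q} (Q? : Dec Q) → let k = (if does Q? then K.1# else K.0#) K.+ K.0# in
              (Q → k K.≈ K.1#) × (¬ Q → k K.≈ K.0#)
      truth (yes q) = (λ _ → K.+-identityʳ K.1#) , λ ¬q → contradiction q ¬q
      truth (no ¬q) = (λ q → contradiction q ¬q) , λ _ → K.+-identityʳ K.0#

    indicates-∙ : ∀ {q} {Q : Set q} {k x} → k K.≈ K.1# → Indicates π x Q → Indicates π (k ∙ x) Q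
    indicates-∙ {k = k} {x} k≈1 (holds , fails) =
      (λ Q → K.trans scaled (holds Q)) , λ ¬Q → K.trans scaled (fails ¬Q)
      where
      scaled = K.trans (coefficient-∙ k x π) (K.trans (K.*-congʳ k≈1) (K.*-identityˡ _))

    module _ {a q} {A : Set a} {Q : A → Set q} {f : A → FQSym} where

      -- At most one entry satisfies `Q` and no entry is repeated, so at most one summand
      -- contributes `1#` and ones are never added up.
      indicates-concatMap : ∀ {xs} → Unique xs → (∀ {x} → x ∈ xs → Indicates π (f x) (Q x)) →
        (∀ {x y} → x ∈ xs → y ∈ xs → Q x → Q y → x ≡ y) →
        Indicates π (concatMap f xs) (∃ λ x → x ∈ xs × Q x)
      indicates-concatMap {[]} _ _ _ = (λ ()) , λ _ → K.refl
      indicates-concatMap {x ∷ xs} (x∉xs ∷ xs!) ind same = holds , fails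
        where
        rest : Indicates π (concatMap f xs) (∃ λ x → x ∈ xs × Q x)
        rest = indicates-concatMap xs! (ind ∘ there) (λ y∈ z∈ → same (there y∈) (there z∈))

        holds : (∃ λ y → y ∈ x ∷ xs × Q y) → coefficient (concatMap f (x ∷ xs)) π K.≈ K.1#
        holds (_ , here refl , Qx) = K.trans (coefficient-++ (f x) _ π) (K.trans
          (K.+-cong (coefficient≈1 (ind (here refl)) Qx)
                  (coefficient≈0 rest λ (y , y∈ , Qy) → All.lookup x∉xs y∈ (same (here refl) (there y∈) Qx Qy)))
          (K.+-identityʳ K.1#))
        holds (y , there y∈ , Qy) = K.trans (coefficient-++ (f x) _ π) (K.trans
          (K.+-cong (coefficient≈0 (ind (here refl)) λ Qx → All.lookup x∉xs y∈ (same (here refl) (there y∈) Qx Qy))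
                  (coefficient≈1 rest (y , y∈ , Qy)))
          (K.+-identityˡ K.1#))

        fails : ¬ (∃ λ y → y ∈ x ∷ xs × Q y) → coefficient (concatMap f (x ∷ xs)) π K.≈ K.0#
        fails ¬Q = K.trans (coefficient-++ (f x) _ π) (K.trans
          (K.+-cong (coefficient≈0 (ind (here refl)) λ Qx → ¬Q (x , here refl , Qx))
                  (coefficient≈0 rest λ (y , y∈ , Qy) → ¬Q (y , there y∈ , Qy)))
          (K.+-identityʳ K.0#))

      indicates-∑ : ∀ {p} {P : A → Set p} (E : Enumeration P) → (∀ x → P x → Indicates π (f x) (Q x)) →
        (∀ {x y} → P x → P y → Q x → Q y → x ≡ y) → Indicates π (∑ E f) (∃ λ x → P x × Q x)
      indicates-∑ E ind same = indicates-⇔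
        (λ (x , x∈ , Qx) → x , sound x∈ , Qx) (λ (x , Px , Qx) → x , complete Px , Qx)
        (indicates-concatMap unique (λ {x} x∈ → ind x (sound x∈)) λ x∈ y∈ → same (sound x∈) (sound y∈))
        where open Enumeration E

    indicates-∑𝐅 : ∀ {p} {P : 𝔖 → Set p} (E : Enumeration P) → Indicates π (∑[ σ ∈ E ] 𝐅 σ) (P π)
    indicates-∑𝐅 E = indicates-⇔ (λ { (_ , Pπ , refl) → Pπ }) (λ Pπ → π , Pπ , refl)
      (indicates-∑ E (λ σ _ → indicates-𝐅 σ) λ { _ _ refl refl → refl })

    -- The product runs over the terms of formal sums. Each term of a sum of `𝐅`s has coefficient
    -- `1#`, so the product can be indexed by the enumeration itself.
    concatMap-∑𝐅 : ∀ {p} {P : 𝔖 → Set p} (E : Enumeration P) (g : K.Carrier × 𝔖 → FQSym) →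
                   concatMap g (∑[ σ ∈ E ] 𝐅 σ) ≡ (∑[ σ ∈ E ] g (K.1# , σ))
    concatMap-∑𝐅 E g = go (Enumeration.elements E)
      where
      go : ∀ σs → concatMap g (concatMap 𝐅 σs) ≡ concatMap (λ σ → g (K.1# , σ)) σs
      go []       = refl
      go (σ ∷ σs) = cong (g (K.1# , σ) ++_) (go σs)

    indicates-product : ∀ J₀ J₁ → Indicates π (𝐏 J₀ · 𝐏 J₁)
      (∃ λ σ → Fibre J₀ σ × (∃ λ ν → Fibre J₁ ν × ShiftedShuffle σ ν π))
    indicates-product J₀ J₁ = subst (λ x → Indicates π x _) (sym (concatMap-∑𝐅 (fibre J₀) _))
      (indicates-∑ (fibre J₀)
        (λ σ _ → subst (λ x → Indicates π x _) (sym (concatMap-∑𝐅 (fibre J₁) _))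
          (indicates-∑ (fibre J₁)
            (λ ν _ → indicates-∙ (K.*-identityˡ K.1#) (indicates-∑𝐅 (shiftedShuffles σ ν)))
            λ {ν} {ν′} _ _ j j′ → proj₂ (shuffle-unique {σ} {ν} {σ} {ν′} {π} refl j j′)))
        λ {σ} {σ′} σ∈ σ′∈ (ν , _ , j) (ν′ , _ , j′) →
          proj₁ (shuffle-unique {σ} {ν} {σ′} {ν′} {π} (trans (fibre-size J₀ σ σ∈) (sym (fibre-size J₀ σ′ σ′∈))) j j′))

    indicates-interval : ∀ J₀ J₁ → Indicates π (∑[ J ∈ interval J₀ J₁ ] 𝐏 J)
      (∃ λ J → (J₀ ≤B J × J ≤B J₁) × Fibre J π)
    indicates-interval J₀ J₁ = indicates-∑ (interval J₀ J₁) (λ J _ → indicates-∑𝐅 (fibre J))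
      λ _ _ π∈J π∈J′ → trees-injective (trans (sym π∈J) π∈J′)

corollary6p7 : ∀ {c ℓ₁ ℓ₂} (K : HeytingField c ℓ₁ ℓ₂) → CharacteristicZero K →
    let open FQSymOver K in
    (J₀ J₁ : TwinPair) → 𝐏 J₀ · 𝐏 J₁ ≈ ∑[ J ∈ interval (J₀ / J₁) (J₀ ∖ J₁) ] 𝐏 J
corollary6p7 K _ J₀ J₁ π =
  -- Both sides indicate that `twinTrees π` lies in the interval, and the Baxter order is decidable,
  -- so two cases suffice.
  agree ((J₀ / J₁ ≤B? twinTrees π) ×-dec (twinTrees π ≤B? J₀ ∖ J₁))
        (indicates-product K J₀ J₁) (indicates-interval K (J₀ / J₁) (J₀ ∖ J₁))
  where
  module K = CommutativeRing
    (HeytingCommutativeRing.commutativeRing (HeytingField.heytingCommutativeRing K))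
  open FQSymOver K using (coefficient)

  toShuffle : ∀ {J} → (J₀ / J₁ ≤B J × J ≤B J₀ ∖ J₁) × Fibre J π →
              ∃ λ σ → Fibre J₀ σ × (∃ λ ν → Fibre J₁ ν × ShiftedShuffle σ ν π)
  toShuffle {J} ((≤J , J≤) , π∈) = interval⇒shuffle J₀ J₁ J π ≤J J≤ π∈

  agree : ∀ {x y} → Dec (J₀ / J₁ ≤B twinTrees π × twinTrees π ≤B J₀ ∖ J₁) →
    Indicates K π x (∃ λ σ → Fibre J₀ σ × (∃ λ ν → Fibre J₁ ν × ShiftedShuffle σ ν π)) →
    Indicates K π y (∃ λ J → (J₀ / J₁ ≤B J × J ≤B J₀ ∖ J₁) × Fibre J π) →
    coefficient x π K.≈ coefficient y π
  agree (yes between) (holds , _) (holds′ , _) =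
    K.trans (holds (toShuffle {twinTrees π} (between , ℙ≡treePair π)))
            (K.sym (holds′ (twinTrees π , between , ℙ≡treePair π)))
  agree (no ¬between) (_ , fails) (_ , fails′) = K.trans
    (fails λ (σ , σ∈ , ν , ν∈ , j) →
      ¬between (shuffle⇒interval J₀ J₁ (twinTrees π) σ ν π σ∈ ν∈ (ℙ≡treePair π) j))
    (K.sym (fails′ λ (J , between , π∈) → ¬between
      (subst (λ J → J₀ / J₁ ≤B J × J ≤B J₀ ∖ J₁)
             (trees-injective {J} {twinTrees π} (trans (sym π∈) (ℙ≡treePair π))) between)))
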